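{- (1) Each set in $\mathrm{NP}$, except $\emptyset$ and $\Sigma^*$, is polynomial-time many-one equivalent to a set that is not tight paddable (and thus not tight Z-paddable). (2) There exists an $\mathrm{NP}$-complete set that is not tight paddable (and thus not tight Z-paddable). (3) There exists a polynomial-time computable set that is not tight paddable (and thus not tight Z-paddable).
   Context: $\Sigma=\{0,1\}$; all sets are subsets of $\Sigma^*$; $|x|$ is the length of $x$. A set $A$ is tight paddable if there are a polynomial-time computable $\sigma:\Sigma^*\to\Sigma^*$ and $k\in\mathbb{N}$ such that for each $x\in\Sigma^*$: $\sigma(x)\in A\iff x\in A$, and $|x|<|\sigma(x)|\le|x|+k$. It is tight Z-paddable if such a $\sigma$ exists that is in addition one-to-one. Sets $A$ and $B$ are polynomial-time many-one equivalent if $A\leq^p_m B$ and $B\leq^p_m A$. NP-completeness is with respect to $\leq^p_m$. -}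

module Defs where

open import Data.Bool using (Bool; true)
open import Data.Fin using (Fin)
open import Data.List using (List; []; _∷_; map; length; foldr)
open import Data.List.Membership.Propositional using () renaming (_∈_ to _∈ˡ_)
open import Data.Nat using (ℕ; suc; _+_; _*_; _≤_; _<_)
open import Data.Product using (Σ; ∃-syntax; _×_; _,_)
open import Data.Vec as Vec using (Vec)
open import Function.Bundles using (_⇔_)
open import Function.Definitions using (Injective)
open import Level using (0ℓ)
open import Relation.Binary.PropositionalEquality using (_≡_)
open import Relation.Unary using (Pred; _∈_)

Word : Set
Word = List Bool

Language : Set₁
Language = Pred Word 0ℓ

-- The list a₀ ∷ a₁ ∷ … ∷ a_d ∷ [] stands for a₀ + a₁ n + … + a_d n^d.
Polynomial : Set
Polynomial = List ℕ

⟦_⟧ : Polynomial → ℕ → ℕ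
⟦ p ⟧ n = foldr (λ a r → a + n * r) 0 p

-- A finite tape alphabet: the blank, the two input letters, and `aux`
-- further symbols.
data Symbol (aux : ℕ) : Set where
  blank : Symbol aux
  bit   : Bool → Symbol aux
  extra : Fin aux → Symbol aux

data Move : Set where
  moveL stay moveR : Move

-- A tape that is infinite in both directions.  `left` lists the cells to
-- the left of the head, nearest first, and `right` those to the right of
-- it; all cells beyond the two lists are blank.
record Tape (aux : ℕ) : Set where
  constructor tape
  field
    left  : List (Symbol aux)
    head  : Symbol aux
    right : List (Symbol aux)

open Tape public

shift : ∀ {a} → Move → Tape a → Tape a
shift stay  t                     = t
shift moveL (tape []       h rs)  = tape [] blank (h ∷ rs)
shift moveL (tape (l ∷ ls) h rs)  = tape ls l (h ∷ rs)
shift moveR (tape ls h [])        = tape (h ∷ ls) blank []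
shift moveR (tape ls h (r ∷ rs))  = tape (h ∷ ls) r rs

writeAndMove : ∀ {a} → Symbol a × Move → Tape a → Tape a
writeAndMove (s , m) (tape ls _ rs) = shift m (tape ls s rs)

-- Nondeterministic machines with at least one tape.  `δ` lists the
-- possible actions (new state; for each tape the symbol to write and the
-- head move); the machine halts where this list is empty.
record Machine : Set where
  field
    states     : ℕ
    aux        : ℕ
    extraTapes : ℕ

  tapes : ℕ
  tapes = suc extraTapes

  Action : Set
  Action = Fin states × Vec (Symbol aux × Move) tapes

  field
    start  : Fin states
    accept : Fin states → Bool
    δ      : Fin states → Vec (Symbol aux) tapes → List Action

Deterministic : Machine → Set
Deterministic M = ∀ q s → length (δ q s) ≤ 1
  where open Machine M

module _ (M : Machine) where
  open Machine M

  record Config : Set where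
    constructor config
    field
      state    : Fin states
      contents : Vec (Tape aux) tapes

  open Config

  enabled : Config → List Action
  enabled c = δ (state c) (Vec.map head (contents c))

  apply : Action → Config → Config
  apply (q , ws) c = config q (Vec.zipWith writeAndMove ws (contents c))

  -- Runs t c d: the machine can get from c to d in exactly t steps.
  data Runs : ℕ → Config → Config → Set where
    done : ∀ {c} → Runs 0 c c
    step : ∀ {t c d} (a : Action) → a ∈ˡ enabled c →
           Runs t (apply a c) d → Runs (suc t) c d

  Halted : Config → Set
  Halted c = enabled c ≡ []

  emptyTape : Tape aux
  emptyTape = tape [] blank []

  inputTape : Word → Tape aux
  inputTape []       = emptyTape
  inputTape (b ∷ bs) = tape [] (bit b) (map bit bs)

  -- The input is on the first tape, with the head on its first
  -- letter (on a blank if the input is empty).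
  initial : Word → Config
  initial x = config start (inputTape x Vec.∷ Vec.replicate extraTapes emptyTape)

  leadingBits : List (Symbol aux) → Word
  leadingBits (bit b ∷ ss) = b ∷ leadingBits ss
  leadingBits _            = []

  -- The output is the word that starts at the head of the first tape and
  -- extends to the right up to the first symbol other than 0 and 1.
  output : Config → Word
  output c = leadingBits (head t ∷ right t)
    where t = Vec.head (contents c)

  -- Every computation path on an input of length n has at most p(n) steps.
  RunsInTime : Polynomial → Set
  RunsInTime p = ∀ x {t c} → Runs t (initial x) c → t ≤ ⟦ p ⟧ (length x)

  Accepts : Word → Set
  Accepts x = ∃[ t ] ∃[ c ] Runs t (initial x) c × Halted c × accept (Config.state c) ≡ true

  Outputs : Word → Word → Set
  Outputs x y = ∃[ t ] ∃[ c ] Runs t (initial x) c × Halted c × output c ≡ y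

PolyTimeComputable : (Word → Word) → Set
PolyTimeComputable f =
  Σ Machine λ M → Deterministic M × (∃[ p ] RunsInTime M p) × (∀ x → Outputs M x (f x))

InP : Language → Set
InP A =
  Σ Machine λ M → Deterministic M × (∃[ p ] RunsInTime M p) × (∀ x → x ∈ A ⇔ Accepts M x)

InNP : Language → Set
InNP A =
  Σ Machine λ M → (∃[ p ] RunsInTime M p) × (∀ x → x ∈ A ⇔ Accepts M x)

infix 4 _≤ᵖₘ_ _≡ᵖₘ_

_≤ᵖₘ_ : Language → Language → Set
A ≤ᵖₘ B = ∃[ f ] PolyTimeComputable f × (∀ x → x ∈ A ⇔ f x ∈ B)

_≡ᵖₘ_ : Language → Language → Set
A ≡ᵖₘ B = A ≤ᵖₘ B × B ≤ᵖₘ A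

NPComplete : Language → Set₁
NPComplete B = InNP B × (∀ A → InNP A → A ≤ᵖₘ B)

TightPadding : Language → (Word → Word) → ℕ → Set
TightPadding A σ k =
  PolyTimeComputable σ ×
  (∀ x → (σ x ∈ A ⇔ x ∈ A) × length x < length (σ x) × length (σ x) ≤ length x + k)

TightPaddable : Language → Set
TightPaddable A = ∃[ σ ] ∃[ k ] TightPadding A σ k

TightZPaddable : Language → Set
TightZPaddable A = ∃[ σ ] ∃[ k ] TightPadding A σ k × Injective _≡_ _≡_ σ

{-# OPTIONS --safe #-}

-- Call a word padded if it has the form 0^(1+2+…+n) 1 x with n = |x|. The lengths of the padded words
-- have unbounded gaps, so iterating a tight padding of a nonempty set of padded words eventually
-- produces a member inside a gap: such a set is not tight paddable. Since padding and unpadding are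
-- computable in polynomial time, every nontrivial set A is equivalent to the set of the padded forms of its members.
--
-- For an NP-complete set of padded words, a nondeterministic machine is split into tracks, each
-- recording a single bit: whether the machine is in state q, or whether a cell of tape i holds
-- the letter a. On one track every rule of the machine becomes "if the bit at the head is b, write b′ and
-- move", and a computation is a list of rules that is applicable on all tracks. An instance
-- lists, track by track, the initial bits and T copies of all the rules, where T bounds the running
-- time; a certificate selects rules from this list and is replayed on each track in turn.
--
-- Polynomial-time computability is obtained from a small language of programs over stacks of bits,
-- which compile to machines. A syntactic criterion bounds their running time: no
-- iteration of a loop may increase the total height of the stacks that loops run over.

module Submission where

open import Defs
open import Data.Bool as Bool using (Bool; true; false; T; not; _∧_; _∨_; if_then_else_)
open import Data.Empty using (⊥-elim)
open import Data.Fin as Fin using (Fin; zero; suc; #_)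
open import Data.Fin.Properties using (splitAt-join)
open import Data.List as List using (List; []; _∷_; [_]; length; _++_; _ʳ++_; reverse; replicate)
open import Data.List.Membership.Propositional using () renaming (_∈_ to _∈ˡ_)
open import Data.List.Membership.Propositional.Properties
  using (∈-map⁺; ∈-++⁺ˡ; ∈-++⁺ʳ; ∈-concatMap⁺; ∈-cartesianProduct⁺; ∈-cartesianProductWith⁺; ∈-allFin)
open import Data.List.Properties using (length-++; length-ʳ++; length-replicate; ++-ʳ++; ʳ++-ʳ++; ʳ++-defn; ++-identityʳ; ++-assoc; length-map; length-reverse; reverse-involutive; ∷-injectiveʳ; reverse-map; map-∘; map-++; concatMap-++)
open import Data.List.Relation.Unary.All as All using (All; []; _∷_)
import Data.List.Relation.Unary.All.Properties as All
open import Data.List.Relation.Unary.Any as Any using (here; there)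
open import Data.Maybe using (Maybe; just; nothing)
open import Data.Nat using (ℕ; zero; suc; _+_; _*_; _∸_; _⊔_; _≤_; _<_; z≤n; s≤s; _≤ᵇ_; _≟_)
open import Data.Nat.Properties hiding (_≟_)
open import Data.Product using (∃-syntax; _×_; _,_; proj₁; proj₂)
open import Data.Sum as Sum using (_⊎_; inj₁; inj₂)
import Data.Sum.Properties as Sum
open import Data.Unit using (⊤; tt)
open import Data.Vec as Vec using (Vec; []; _∷_; lookup; _[_]≔_; _[_]%=_; zipWith)
open import Data.Vec.Properties using (lookup∘updateAt; lookup∘updateAt′; updateAt-id; updateAt-updateAt; lookup-map; lookup-replicate; lookup-zipWith)
open import Function using (_∘_; const; id)
open import Function.Bundles using (_⇔_; mk⇔; Equivalence)
open import Relation.Binary.Definitions using (DecidableEquality)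
open import Relation.Binary.PropositionalEquality hiding ([_])
open import Relation.Nullary using (¬_; yes; no; does)
open import Relation.Unary using (_∈_; _∉_)
open import Data.Nat.Solver using (module +-*-Solver)
open +-*-Solver using (solve; con; _:+_; _:*_; _:=_)

-- Triangular numbers of zeros are used because a loop whose counter grows by one in each round
-- produces them. Words that are not padded need a nonmember as their image under unpadding, and the
-- gap argument needs a member to start from: hence the two exceptions in the first claim.
--
-- The second claim is not derived from the first, which would presuppose an NP-complete set. The
-- obstacle is that one fixed machine has to verify computations of machines with any number of
-- states, letters and tapes. Tracks of single bits fit on a fixed number of stacks, but a single
-- track does not reveal which rule is applicable. So the certificate fixes the rules for all tracks
-- at once, and each rule names the state and all scanned symbols; it is applicable exactly if its
-- bit agrees on every track.
--
-- For the third claim the set that contains only the empty word suffices, as a padding of the empty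
-- word would be a longer member.

infixr 4 _⨾_

-- Programs over stacks of bits, their meaning and their cost

data Prog (n : ℕ) : Set where
  push : Fin (suc n) → Word → Prog n
  _⨾_  : Prog n → Prog n → Prog n
  pop  : Fin (suc n) → (Bool → Prog n) → Prog n → Prog n
  for  : Fin (suc n) → (Bool → Prog n) → Prog n

Stacks : ℕ → Set
Stacks n = Vec Word (suc n)

loop : ∀ {n} → ℕ → Fin (suc n) → (Bool → Stacks n → Stacks n) → Stacks n → Stacks n
loopStep : ∀ {n} → ℕ → Fin (suc n) → (Bool → Stacks n → Stacks n) → Word → Stacks n → Stacks n
loop zero    i f s = s
loop (suc m) i f s = loopStep m i f (lookup s i) s
loopStep m i f []      s = s
loopStep m i f (b ∷ w) s = loop m i f (f b (s [ i ]≔ w))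

-- `for` pops until the stack is empty. Here its fuel is the initial height of that stack, which
-- is only adequate if the body never pushes on it (`keeps` below).
eval : ∀ {n} → Prog n → Stacks n → Stacks n
evalPop : ∀ {n} → Fin (suc n) → (Bool → Prog n) → Prog n → Word → Stacks n → Stacks n
eval (push i w)  s = s [ i ]%= (w ʳ++_)
eval (p ⨾ q)     s = eval q (eval p s)
eval (pop i p e) s = evalPop i p e (lookup s i) s
eval (for i p)   s = loop (length (lookup s i)) i (λ b → eval (p b)) s
evalPop i p e []      s = eval e s
evalPop i p e (b ∷ w) s = eval (p b) (s [ i ]≔ w)

-- Costs are exact numbers of machine steps. A pushed letter takes two (a move to the left, then a
-- write), and the end of the word takes one idle step.
pushCost : Word → ℕ
pushCost []      = 1
pushCost (b ∷ w) = 2 + pushCost w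

loopCost : ∀ {n} → ℕ → Fin (suc n) → (Bool → Stacks n → Stacks n) → (Bool → Stacks n → ℕ) → Stacks n → ℕ
loopCostStep : ∀ {n} → ℕ → Fin (suc n) → (Bool → Stacks n → Stacks n) → (Bool → Stacks n → ℕ) → Word → Stacks n → ℕ
loopCost zero    i f c s = 1
loopCost (suc m) i f c s = loopCostStep m i f c (lookup s i) s
loopCostStep m i f c []      s = 1
loopCostStep m i f c (b ∷ w) s = suc (c b (s [ i ]≔ w) + loopCost m i f c (f b (s [ i ]≔ w)))

cost : ∀ {n} → Prog n → Stacks n → ℕ
popCost : ∀ {n} → Fin (suc n) → (Bool → Prog n) → Prog n → Word → Stacks n → ℕ
cost (push i w)  s = pushCost w
cost (p ⨾ q)     s = cost p s + cost q (eval p s)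
cost (pop i p e) s = suc (popCost i p e (lookup s i) s)
cost (for i p)   s = loopCost (length (lookup s i)) i (λ b → eval (p b)) (λ b → cost (p b)) s
popCost i p e []      s = cost e s
popCost i p e (b ∷ w) s = cost (p b) (s [ i ]≔ w)

infix 5 _==_

_==_ : ∀ {n} → Fin n → Fin n → Bool
i == j = does (i Fin.≟ j)

isNil : Word → Bool
isNil []      = true
isNil (_ ∷ _) = false

keeps : ∀ {n} → Fin (suc n) → Prog n → Bool
keeps i (push j w)  = not (i == j) ∨ isNil w
keeps i (p ⨾ q)     = keeps i p ∧ keeps i q
keeps i (pop j p e) = keeps i (p false) ∧ keeps i (p true) ∧ keeps i e
keeps i (for j p)   = keeps i (p false) ∧ keeps i (p true)

-- A program and its machine could only disagree when a loop runs out of fuel before its stack is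
-- empty. This condition excludes that.
wf : ∀ {n} → Prog n → Bool
wf (push i w)  = true
wf (p ⨾ q)     = wf p ∧ wf q
wf (pop i p e) = wf (p false) ∧ wf (p true) ∧ wf e
wf (for i p)   = (keeps i (p false) ∧ keeps i (p true)) ∧ (wf (p false) ∧ wf (p true))

∧-T : ∀ {a b} → T (a ∧ b) → T a × T b
∧-T {true} t = tt , t

both : (P : Bool → Set) → P false → P true → ∀ b → P b
both P f t false = f
both P f t true  = t

∧-bool : ∀ (g : Bool → Bool) → T (g false ∧ g true) → ∀ b → T (g b)
∧-bool g t = both (T ∘ g) (proj₁ (∧-T t)) (proj₂ (∧-T {g false} t))

lookup-≔-≤ : ∀ {n} (s : Stacks n) i j {b w} → lookup s j ≡ b ∷ w →
  length (lookup (s [ j ]≔ w) i) ≤ length (lookup s i)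
lookup-≔-≤ s i j {b} {w} eq with i Fin.≟ j
... | yes refl rewrite lookup∘updateAt i {const w} s | eq = n≤1+n _
... | no i≢j rewrite lookup∘updateAt′ i j {const w} i≢j s = ≤-refl

loop-keeps : ∀ {n} m (i j : Fin (suc n)) f →
  (∀ b s → length (lookup (f b s) i) ≤ length (lookup s i)) →
  ∀ s → length (lookup (loop m j f s) i) ≤ length (lookup s i)
loop-keeps zero i j f h s = ≤-refl
loop-keeps (suc m) i j f h s with lookup s j in eq
... | [] = ≤-refl
... | b ∷ w = ≤-trans (loop-keeps m i j f h _) (≤-trans (h b _) (lookup-≔-≤ s i j eq))

eval-keeps : ∀ {n} (i : Fin (suc n)) p → T (keeps i p) →
  ∀ s → length (lookup (eval p s) i) ≤ length (lookup s i)
eval-keeps i (push j []) k s = ≤-reflexive (cong (λ s → length (lookup s i)) (updateAt-id j s))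
eval-keeps i (push j (b ∷ w)) k s with i Fin.≟ j
... | no i≢j = ≤-reflexive (cong length (lookup∘updateAt′ i j i≢j s))
eval-keeps i (p ⨾ q) k s with kp , kq ← ∧-T {keeps i p} k =
  ≤-trans (eval-keeps i q kq _) (eval-keeps i p kp s)
eval-keeps i (pop j p e) k s with k₀ , k₁₂ ← ∧-T {keeps i (p false)} k
  with k₁ , k₂ ← ∧-T {keeps i (p true)} k₁₂ with lookup s j in eq
... | [] = eval-keeps i e k₂ s
... | false ∷ w = ≤-trans (eval-keeps i (p false) k₀ _) (lookup-≔-≤ s i j eq)
... | true ∷ w = ≤-trans (eval-keeps i (p true) k₁ _) (lookup-≔-≤ s i j eq)
eval-keeps i (for j p) k s =
  loop-keeps (length (lookup s j)) i j _
    (λ b → eval-keeps i (p b) (∧-bool (keeps i ∘ p) k b)) s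

-- Compilation

PushPos : Word → Set
PushPos []      = ⊤
PushPos (b ∷ w) = Bool ⊎ PushPos w

-- The control points, which become the states of the machine. The exit is not among them but a
-- parameter of `step′`, so that it can be the entry of the next program or the head of an enclosing
-- loop.
Pos : ∀ {n} → Prog n → Set
Pos (push i w)  = PushPos w
Pos (p ⨾ q)     = Pos p ⊎ Pos q
Pos (pop i p e) = ⊤ ⊎ (Pos (p false) ⊎ Pos (p true)) ⊎ Pos e
Pos (for i p)   = ⊤ ⊎ (Pos (p false) ⊎ Pos (p true))

record Finite (A : Set) : Set where
  field
    card    : ℕ
    enc     : A → Fin card
    dec     : Fin card → A
    dec-enc : ∀ a → dec (enc a) ≡ a
open Finite

finite-⊤ : Finite ⊤
finite-⊤ = record { card = 1 ; enc = λ _ → zero ; dec = λ _ → tt ; dec-enc = λ _ → refl }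

finite-Bool : Finite Bool
finite-Bool = record
  { card = 2 ; enc = λ { false → zero ; true → suc zero } ; dec = λ { zero → false ; (suc _) → true }
  ; dec-enc = λ { false → refl ; true → refl } }

finite-⊎ : ∀ {A B} → Finite A → Finite B → Finite (A ⊎ B)
finite-⊎ {A} {B} a b = record
  { card = card a + card b
  ; enc = λ x → Fin.join (card a) (card b) (Sum.map (enc a) (enc b) x)
  ; dec = λ i → Sum.map (dec a) (dec b) (Fin.splitAt (card a) i)
  ; dec-enc = λ x → trans (cong (Sum.map (dec a) (dec b)) (splitAt-join (card a) (card b) (Sum.map (enc a) (enc b) x))) (lemma x) }
  where
  lemma : ∀ x → Sum.map (dec a) (dec b) (Sum.map (enc a) (enc b) x) ≡ x
  lemma (inj₁ x) = cong inj₁ (dec-enc a x)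
  lemma (inj₂ y) = cong inj₂ (dec-enc b y)

finite-PushPos : ∀ w → Finite (PushPos w)
finite-PushPos []      = finite-⊤
finite-PushPos (b ∷ w) = finite-⊎ finite-Bool (finite-PushPos w)

finite-Pos : ∀ {n} (p : Prog n) → Finite (Pos p)
finite-Pos (push i w)  = finite-PushPos w
finite-Pos (p ⨾ q)     = finite-⊎ (finite-Pos p) (finite-Pos q)
finite-Pos (pop i p e) = finite-⊎ finite-⊤ (finite-⊎ (finite-⊎ (finite-Pos (p false)) (finite-Pos (p true))) (finite-Pos e))
finite-Pos (for i p)   = finite-⊎ finite-⊤ (finite-⊎ (finite-Pos (p false)) (finite-Pos (p true)))

pushEntry : ∀ w → PushPos w
pushEntry []      = tt
pushEntry (b ∷ w) = inj₁ false

entry : ∀ {n} (p : Prog n) → Pos p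
entry (push i w)  = pushEntry w
entry (p ⨾ q)     = inj₁ (entry p)
entry (pop i p e) = inj₁ tt
entry (for i p)   = inj₁ tt

Actions : ℕ → Set
Actions n = Vec (Symbol 0 × Move) (suc n)

idle : ∀ {k a} → Vec (Symbol a) k → Vec (Symbol a × Move) k
idle = Vec.map (_, stay)

at : ∀ {k} → Fin k → (Symbol 0 → Symbol 0 × Move) → Vec (Symbol 0) k → Vec (Symbol 0 × Move) k
at i g ss = idle ss [ i ]≔ g (lookup ss i)

popTo : ∀ {Q : Set} → (Bool → Q) → Q → Symbol 0 → Q
popTo onBit onEmpty (bit b) = onBit b
popTo onBit onEmpty _       = onEmpty

popAct : Symbol 0 → Symbol 0 × Move
popAct (bit b) = blank , moveR
popAct s       = s , stay

branch : ∀ {P : Bool → Set} {Q : Set} → (P false ⊎ P true → Q) → ∀ b → P b → Q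
branch emb false = emb ∘ inj₁
branch emb true  = emb ∘ inj₂

module _ {n : ℕ} {Q : Set} where

  pushStep : Fin (suc n) → ∀ w → (PushPos w → Q) → Q → PushPos w → Vec (Symbol 0) (suc n) → Q × Actions n
  pushStep i []      emb exit pos          ss = exit , idle ss
  pushStep i (b ∷ w) emb exit (inj₁ false) ss = emb (inj₁ true) , at i (_, moveL) ss
  pushStep i (b ∷ w) emb exit (inj₁ true)  ss = emb (inj₂ (pushEntry w)) , at i (λ _ → bit b , stay) ss
  pushStep i (b ∷ w) emb exit (inj₂ pos)   ss = pushStep i w (emb ∘ inj₂) exit pos ss

  step′ : ∀ (p : Prog n) → (Pos p → Q) → Q → Pos p → Vec (Symbol 0) (suc n) → Q × Actions n
  step′ (push i w)  emb exit pos ss = pushStep i w emb exit pos ss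
  step′ (p ⨾ q)     emb exit (inj₁ pos) ss = step′ p (emb ∘ inj₁) (emb (inj₂ (entry q))) pos ss
  step′ (p ⨾ q)     emb exit (inj₂ pos) ss = step′ q (emb ∘ inj₂) exit pos ss
  step′ (pop i p e) emb exit (inj₁ tt) ss =
    popTo (λ b → branch {Pos ∘ p} (emb ∘ inj₂ ∘ inj₁) b (entry (p b))) (emb (inj₂ (inj₂ (entry e)))) (lookup ss i)
    , at i popAct ss
  step′ (pop i p e) emb exit (inj₂ (inj₁ (inj₁ pos))) ss = step′ (p false) (emb ∘ inj₂ ∘ inj₁ ∘ inj₁) exit pos ss
  step′ (pop i p e) emb exit (inj₂ (inj₁ (inj₂ pos))) ss = step′ (p true) (emb ∘ inj₂ ∘ inj₁ ∘ inj₂) exit pos ss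
  step′ (pop i p e) emb exit (inj₂ (inj₂ pos)) ss = step′ e (emb ∘ inj₂ ∘ inj₂) exit pos ss
  step′ (for i p)   emb exit (inj₁ tt) ss =
    popTo (λ b → branch {Pos ∘ p} (emb ∘ inj₂) b (entry (p b))) exit (lookup ss i)
    , at i popAct ss
  step′ (for i p)   emb exit (inj₂ (inj₁ pos)) ss = step′ (p false) (emb ∘ inj₂ ∘ inj₁) (emb (inj₁ tt)) pos ss
  step′ (for i p)   emb exit (inj₂ (inj₂ pos)) ss = step′ (p true) (emb ∘ inj₂ ∘ inj₂) (emb (inj₁ tt)) pos ss

-- Deterministic runs

module _ (M : Machine) where
  open Machine M

  -- A run without alternatives: every other run from its first configuration follows it. Nothing is
  -- asked of the machine elsewhere, so the notion also serves for the deterministic phases of the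
  -- guessing machine.
  data DRuns : ℕ → Config M → Config M → Set where
    done : ∀ {c} → DRuns 0 c c
    step : ∀ {t c d} a → enabled M c ≡ [ a ] → DRuns t (apply M a c) d → DRuns (suc t) c d

  Terminates : Config M → ℕ → Set
  Terminates c t = ∀ {u d} → Runs M u c d → u ≤ t

  Good : Config M → Set
  Good c = ∃[ t ] ∃[ d ] Runs M t c d × Halted M d × accept (Config.state d) ≡ true

module _ {M : Machine} where
  open Machine M

  drun-++ : ∀ {t u c d e} → DRuns M t c d → DRuns M u d e → DRuns M (t + u) c e
  drun-++ done        r = r
  drun-++ (step a p q) r = step a p (drun-++ q r)

  drun⇒run : ∀ {t c d} → DRuns M t c d → Runs M t c d
  drun⇒run done = done
  drun⇒run (step a p q) = step a (subst (a ∈ˡ_) (sym p) (here refl)) (drun⇒run q)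

  drun-terminates : ∀ {t u c d} → DRuns M t c d → Terminates M d u → Terminates M c (t + u)
  drun-terminates done tm r = tm r
  drun-terminates (step a p q) tm done = z≤n
  drun-terminates (step a p q) tm (step a′ p′ r) with subst (a′ ∈ˡ_) p p′
  ... | here refl = s≤s (drun-terminates q tm r)

  halted-terminates : ∀ {c} → Halted M c → Terminates M c 0
  halted-terminates h done = z≤n
  halted-terminates h (step a p r) with subst (a ∈ˡ_) h p
  ... | ()

  drun-good : ∀ {t c d} → DRuns M t c d → Good M d → Good M c
  drun-good done g = g
  drun-good (step a p q) g with drun-good q g
  ... | t , d , r , h , e = suc t , d , step a (subst (a ∈ˡ_) (sym p) (here refl)) r , h , e

  good-drun : ∀ {t c d} → DRuns M t c d → Good M c → Good M d
  good-drun done g = g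
  good-drun (step a p q) (_ , d , done , h , e) with () ← trans (sym p) h
  good-drun (step a p q) (_ , d , step a′ p′ r , h , e) with subst (a′ ∈ˡ_) p p′
  ... | here refl = good-drun q (_ , d , r , h , e)


-- Simulation of programs by machines

module Simulation {n states : ℕ} (start : Fin states) (acc : Fin states → Bool)
  (δ : Fin states → Vec (Symbol 0) (suc n) → List (Fin states × Actions n)) where

  M : Machine
  M = record { states = states ; aux = 0 ; extraTapes = n ; start = start ; accept = acc ; δ = δ }

  Tapes : Set
  Tapes = Vec (Tape 0) (suc n)

  -- The top of the stack is at the head. Cells to the left of the head may hold anything, because a
  -- push overwrites the cell to which it moves.
  stack : Tape 0 → Word
  stack t = leadingBits M (head t ∷ right t)

  leadingBits-map : ∀ x → leadingBits M (List.map bit x) ≡ x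
  leadingBits-map []      = refl
  leadingBits-map (b ∷ x) = cong (b ∷_) (leadingBits-map x)

  stacks : Tapes → Stacks n
  stacks = Vec.map stack

  idle-apply : ∀ {k} (ts : Vec (Tape 0) k) → zipWith writeAndMove (idle (Vec.map head ts)) ts ≡ ts
  idle-apply []       = refl
  idle-apply (t ∷ ts) = cong (t ∷_) (idle-apply ts)

  at-apply : ∀ {k} (i : Fin k) g (ts : Vec (Tape 0) k) →
    zipWith writeAndMove (at i g (Vec.map head ts)) ts ≡ ts [ i ]%= (λ t → writeAndMove (g (head t)) t)
  at-apply zero    g (t ∷ ts) = cong (_ ∷_) (idle-apply ts)
  at-apply (suc i) g (t ∷ ts) = cong (t ∷_) (at-apply i g ts)

  map-%= : ∀ {k} (i : Fin k) {f : Tape 0 → Tape 0} {g : Word → Word} (ts : Vec (Tape 0) k) →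
    stack (f (lookup ts i)) ≡ g (stack (lookup ts i)) →
    Vec.map stack (ts [ i ]%= f) ≡ (Vec.map stack ts) [ i ]%= g
  map-%= zero    (t ∷ ts) e = cong (_∷ _) e
  map-%= (suc i) (t ∷ ts) e = cong (_ ∷_) (map-%= i ts e)

  DR : ℕ → Fin states × Tapes → Fin states × Tapes → Set
  DR t (q , ts) (q′ , ts′) = DRuns M t (config q ts) (config q′ ts′)

  Reaches : ℕ → Fin states → Tapes → Fin states → Stacks n → Set
  Reaches t q ts q′ s = ∃[ ts′ ] DR t (q , ts) (q′ , ts′) × stacks ts′ ≡ s

  reach-trans : ∀ {t u q ts q′ s q″ s′} → Reaches t q ts q′ s →
    (∀ ts′ → stacks ts′ ≡ s → Reaches u q′ ts′ q″ s′) → Reaches (t + u) q ts q″ s′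
  reach-trans (ts′ , r , e) k with k ts′ e
  ... | ts″ , r′ , e′ = ts″ , drun-++ r r′ , e′

  step-at : ∀ {q q′ i} g (h : Word → Word) ts →
    δ q (Vec.map head ts) ≡ [ q′ , at i g (Vec.map head ts) ] →
    (let t = lookup ts i in stack (writeAndMove (g (head t)) t) ≡ h (stack t)) →
    Reaches 1 q ts q′ (stacks ts [ i ]%= h)
  step-at {q} {q′} {i} g h ts e eq = _ , step _ e done ,
    trans (cong stacks (at-apply i g ts)) (map-%= i ts eq)

  step-idle : ∀ {q q′} ts → δ q (Vec.map head ts) ≡ [ q′ , idle (Vec.map head ts) ] →
    Reaches 1 q ts q′ (stacks ts)
  step-idle ts e = _ , step _ e done , cong stacks (idle-apply ts)

  -- Constrains the machine only at the states that `emb` reaches, so that the simulation applies to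
  -- a program nested in a larger one or in the guessing machine.
  Located : ∀ {P : Set} → (P → Fin states) → (P → Vec (Symbol 0) (suc n) → Fin states × Actions n) → Set
  Located emb st = ∀ pos ss → δ (emb pos) ss ≡ [ st pos ss ]

  push-two : ∀ t b → stack (writeAndMove (bit b , stay) (writeAndMove (head t , moveL) t)) ≡ b ∷ stack t
  push-two (tape []       h rs) b = refl
  push-two (tape (l ∷ ls) h rs) b = refl

  push-sim : ∀ i w (emb : PushPos w → Fin states) exit → Located emb (pushStep i w emb exit) →
    ∀ ts → Reaches (pushCost w) (emb (pushEntry w)) ts exit (stacks ts [ i ]%= (w ʳ++_))
  push-sim i [] emb exit loc ts =
    subst (Reaches 1 _ ts exit) (sym (updateAt-id i (stacks ts))) (step-idle ts (loc tt _))
  push-sim i (b ∷ w) emb exit loc ts = reach-trans two λ ts₂ e →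
    subst (Reaches (pushCost w) (emb (inj₂ (pushEntry w))) ts₂ exit)
      (trans (cong (_[ i ]%= (w ʳ++_)) e) (updateAt-updateAt i (stacks ts)))
      (push-sim i w (emb ∘ inj₂) exit (λ pos → loc (inj₂ pos)) ts₂)
    where
    open ≡-Reasoning
    g : Symbol 0 → Symbol 0 × Move
    g _ = bit b , stay
    left′ wr : Tape 0 → Tape 0
    left′ t = writeAndMove (head t , moveL) t
    wr t = writeAndMove (bit b , stay) t
    ts₀ : Tapes
    ts₀ = zipWith writeAndMove (at i (_, moveL) (Vec.map head ts)) ts
    two : Reaches 2 (emb (inj₁ false)) ts (emb (inj₂ (pushEntry w))) (stacks ts [ i ]%= (b ∷_))
    two = _ , step _ (loc (inj₁ false) _) (step _ (loc (inj₁ true) _) done) , (begin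
      stacks (zipWith writeAndMove (at i g (Vec.map head ts₀)) ts₀)  ≡⟨ cong stacks (at-apply i g ts₀) ⟩
      stacks (ts₀ [ i ]%= wr)  ≡⟨ cong (λ ts → stacks (ts [ i ]%= wr)) (at-apply i (_, moveL) ts) ⟩
      stacks (ts [ i ]%= left′ [ i ]%= wr)  ≡⟨ cong stacks (updateAt-updateAt i ts) ⟩
      stacks (ts [ i ]%= (λ t → wr (left′ t))) ≡⟨ map-%= i ts (push-two (lookup ts i) b) ⟩
      stacks ts [ i ]%= (b ∷_) ∎)

  Popped : Fin states → Tapes → Fin (suc n) → (Bool → Fin states) → Fin states → Word → Set
  Popped q ts i f e []      = Reaches 1 q ts e (stacks ts)
  Popped q ts i f e (b ∷ w) = Reaches 1 q ts (f b) (stacks ts [ i ]≔ w)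

  pop-step : ∀ {q i} f e ts →
    δ q (Vec.map head ts) ≡ [ popTo f e (lookup (Vec.map head ts) i) , at i popAct (Vec.map head ts) ] →
    Popped q ts i f e (lookup (stacks ts) i)
  pop-step {q} {i} f e ts d = go (lookup ts i) refl
    where
    popped : ∀ ls rs → stack (shift moveR (tape ls blank rs)) ≡ leadingBits M rs
    popped ls []       = refl
    popped ls (r ∷ rs) = refl
    d′ : ∀ {t} → lookup ts i ≡ t → δ q (Vec.map head ts) ≡ [ popTo f e (head t) , at i popAct (Vec.map head ts) ]
    d′ eq = trans d (cong (λ h → [ popTo f e h , at i popAct (Vec.map head ts) ])
                          (trans (lookup-map i head ts) (cong head eq)))
    written : ∀ {t} → lookup ts i ≡ t →
      stack (writeAndMove (popAct (head (lookup ts i))) (lookup ts i)) ≡ stack (writeAndMove (popAct (head t)) t)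
    written = cong (λ t → stack (writeAndMove (popAct (head t)) t))
    go : ∀ t → lookup ts i ≡ t → Popped q ts i f e (lookup (stacks ts) i)
    go t@(tape ls blank rs) eq = subst (Popped q ts i f e) (sym (trans (lookup-map i stack ts) (cong stack eq)))
      (subst (Reaches 1 q ts e) (updateAt-id i (stacks ts))
        (step-at popAct id ts (d′ eq) (trans (written eq) (sym (cong stack eq)))))
    go t@(tape ls (bit b) rs) eq = subst (Popped q ts i f e) (sym (trans (lookup-map i stack ts) (cong stack eq)))
      (step-at popAct (const _) ts (d′ eq) (trans (written eq) (popped ls rs)))

  -- Holds for all tapes that represent the given stacks, since the contents outside the stacks are
  -- not controlled after a subprogram; this is the form that `reach-trans` composes.
  sim : ∀ p → T (wf p) → ∀ emb exit → Located emb (step′ p emb exit) →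
    ∀ ts → Reaches (cost p (stacks ts)) (emb (entry p)) ts exit (eval p (stacks ts))
  loop-sim : ∀ i (p : Bool → Prog n) → T (wf (for i p)) → ∀ emb exit → Located emb (step′ (for i p) emb exit) →
    ∀ m ts → length (lookup (stacks ts) i) ≤ m →
    Reaches (loopCost m i (λ b → eval (p b)) (λ b → cost (p b)) (stacks ts)) (emb (inj₁ tt)) ts exit
      (loop m i (λ b → eval (p b)) (stacks ts))
  sim (push i w) ok emb exit loc ts = push-sim i w emb exit loc ts
  sim (p ⨾ q) ok emb exit loc ts with okp , okq ← ∧-T {wf p} ok =
    reach-trans (sim p okp _ _ (λ pos → loc (inj₁ pos)) ts) λ ts′ e →
      subst (λ s → Reaches (cost q s) (emb (inj₂ (entry q))) ts′ exit (eval q s)) e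
        (sim q okq _ _ (λ pos → loc (inj₂ pos)) ts′)
  sim (pop i p e) ok emb exit loc ts with ok₀ , ok₁₂ ← ∧-T {wf (p false)} ok
    with ok₁ , ok₂ ← ∧-T {wf (p true)} ok₁₂
    with lookup (stacks ts) i | pop-step (λ b → branch {Pos ∘ p} (emb ∘ inj₂ ∘ inj₁) b (entry (p b))) (emb (inj₂ (inj₂ (entry e)))) ts (loc (inj₁ tt) _)
  ... | [] | r = reach-trans r λ ts′ eq →
      subst (λ s → Reaches (cost e s) (emb (inj₂ (inj₂ (entry e)))) ts′ exit (eval e s)) eq
        (sim e ok₂ _ _ (λ pos → loc (inj₂ (inj₂ pos))) ts′)
  ... | false ∷ w | r = reach-trans r λ ts′ eq →
      subst (λ s → Reaches (cost (p false) s) (emb (inj₂ (inj₁ (inj₁ (entry (p false)))))) ts′ exit (eval (p false) s)) eq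
        (sim (p false) ok₀ _ _ (λ pos → loc (inj₂ (inj₁ (inj₁ pos)))) ts′)
  ... | true ∷ w | r = reach-trans r λ ts′ eq →
      subst (λ s → Reaches (cost (p true) s) (emb (inj₂ (inj₁ (inj₂ (entry (p true)))))) ts′ exit (eval (p true) s)) eq
        (sim (p true) ok₁ _ _ (λ pos → loc (inj₂ (inj₁ (inj₂ pos)))) ts′)
  sim (for i p) ok emb exit loc ts = loop-sim i p ok emb exit loc _ ts ≤-refl
  loop-sim i p ok emb exit loc zero ts le
    with lookup (stacks ts) i | pop-step (λ b → branch {Pos ∘ p} (emb ∘ inj₂) b (entry (p b))) exit ts (loc (inj₁ tt) _)
  loop-sim i p ok emb exit loc zero ts le | [] | r = r
  loop-sim i p ok emb exit loc (suc m) ts le with oks , okw ← ∧-T {keeps i (p false) ∧ keeps i (p true)} ok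
    with okw₀ , okw₁ ← ∧-T {wf (p false)} okw
    with lookup (stacks ts) i in eq₀ | pop-step (λ b → branch {Pos ∘ p} (emb ∘ inj₂) b (entry (p b))) exit ts (loc (inj₁ tt) _)
  ... | [] | r = r
  ... | b ∷ w | r = reach-trans r λ ts₁ e₁ → reach-trans
      (subst (λ s → Reaches (cost (p b) s) (branch {Pos ∘ p} (emb ∘ inj₂) b (entry (p b))) ts₁ (emb (inj₁ tt)) (eval (p b) s)) e₁ (body b ts₁))
      λ ts₂ e₂ → subst (λ s → Reaches (loopCost m i (λ b → eval (p b)) (λ b → cost (p b)) s) (emb (inj₁ tt)) ts₂ exit
                                   (loop m i (λ b → eval (p b)) s)) e₂
        -- The body leaves the stack of the loop no higher than the pop did, so the fuel `m` is
        -- still adequate.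
        (loop-sim i p ok emb exit loc m ts₂ (subst (λ s → length (lookup s i) ≤ m) (sym e₂)
          (≤-trans (eval-keeps i (p b) (∧-bool (keeps i ∘ p) oks b) _)
            (≤-trans (≤-reflexive (cong length (lookup∘updateAt i (stacks ts)))) (≤-pred le)))))
    where
    body : ∀ b ts → Reaches (cost (p b) (stacks ts)) (branch {Pos ∘ p} (emb ∘ inj₂) b (entry (p b))) ts (emb (inj₁ tt)) (eval (p b) (stacks ts))
    body false ts = sim (p false) okw₀ _ _ (λ pos → loc (inj₂ (inj₁ pos))) ts
    body true  ts = sim (p true) okw₁ _ _ (λ pos → loc (inj₂ (inj₂ pos))) ts

module _ {n : ℕ} (p : Prog n) where

  private
    F : Finite (Pos p ⊎ ⊤)
    F = finite-⊎ (finite-Pos p) finite-⊤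
    exit : Fin (card F)
    exit = enc F (inj₂ tt)

    move : Pos p ⊎ ⊤ → Vec (Symbol 0) (suc n) → List (Fin (card F) × Actions n)
    move (inj₁ pos) ss = [ step′ p (enc F ∘ inj₁) exit pos ss ]
    move (inj₂ tt)  ss = []

    open Simulation {n} (enc F (inj₁ (entry p))) (λ _ → true) (λ q → move (dec F q))

    move-enc : ∀ a ss → move (dec F (enc F a)) ss ≡ move a ss
    move-enc a ss = cong (λ a → move a ss) (dec-enc F a)

    move-det : ∀ a ss → length (move a ss) ≤ 1
    move-det (inj₁ pos) ss = ≤-refl
    move-det (inj₂ tt)  ss = z≤n

  stack-input : ∀ x → stack (inputTape M x) ≡ x
  stack-input []      = refl
  stack-input (b ∷ x) = cong (b ∷_) (leadingBits-map x)

  stacks-empty : ∀ k → Vec.map stack (Vec.replicate k (emptyTape M)) ≡ Vec.replicate k []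
  stacks-empty zero    = refl
  stacks-empty (suc k) = cong ([] ∷_) (stacks-empty k)

  input : Word → Stacks n
  input x = x ∷ Vec.replicate n []

  computes : T (wf p) → ∀ q → (∀ x → cost p (input x) ≤ ⟦ q ⟧ (length x)) →
    PolyTimeComputable (λ x → Vec.head (eval p (input x)))
  computes ok q bound = M , (λ q ss → move-det (dec F q) ss) , (q , λ x {t} {c} r → time x r) , out
    where
    reach : ∀ x → Reaches (cost p (input x)) (enc F (inj₁ (entry p))) (Config.contents (initial M x)) exit (eval p (input x))
    reach x = subst (λ s → Reaches (cost p s) (enc F (inj₁ (entry p))) (Config.contents (initial M x)) exit (eval p s))
      (cong₂ _∷_ (stack-input x) (stacks-empty n))
      (sim p ok (enc F ∘ inj₁) exit (λ pos ss → move-enc (inj₁ pos) ss) (Config.contents (initial M x)))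
    halted : ∀ ts → Halted M (config exit ts)
    halted ts = move-enc (inj₂ tt) _
    time : ∀ x {t c} → Runs M t (initial M x) c → t ≤ ⟦ q ⟧ (length x)
    time x r with reach x
    ... | ts , d , _ = ≤-trans (drun-terminates d (halted-terminates (halted ts)) r)
                         (≤-trans (≤-reflexive (+-identityʳ _)) (bound x))
    top : ∀ (ts : Tapes) {s} → stacks ts ≡ s → stack (Vec.head ts) ≡ Vec.head s
    top (t ∷ ts) refl = refl
    out : ∀ x → Outputs M x (Vec.head (eval p (input x)))
    out x with reach x
    ... | ts , d , e = _ , _ , drun⇒run d , halted ts , top ts e

-- Polynomial bounds

infixl 6 _⊕_
infixl 7 _⊗_

_⊕_ : Polynomial → Polynomial → Polynomial
[]      ⊕ q       = q
(a ∷ p) ⊕ []      = a ∷ p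
(a ∷ p) ⊕ (b ∷ q) = (a + b) ∷ (p ⊕ q)

_⊗_ : Polynomial → Polynomial → Polynomial
[]      ⊗ q = []
(a ∷ p) ⊗ q = List.map (a *_) q ⊕ (0 ∷ p ⊗ q)

_⊚_ : Polynomial → Polynomial → Polynomial
[]      ⊚ q = []
(a ∷ p) ⊚ q = (a ∷ []) ⊕ q ⊗ (p ⊚ q)

X : Polynomial
X = 0 ∷ 1 ∷ []


module _ where
  ⊕-eval : ∀ p q n → ⟦ p ⊕ q ⟧ n ≡ ⟦ p ⟧ n + ⟦ q ⟧ n
  ⊕-eval []      q       n = refl
  ⊕-eval (a ∷ p) []      n = sym (+-identityʳ _)
  ⊕-eval (a ∷ p) (b ∷ q) n rewrite ⊕-eval p q n =
    solve 5 (λ a b n x y → (a :+ b) :+ n :* (x :+ y) := (a :+ n :* x) :+ (b :+ n :* y)) refl a b n (⟦ p ⟧ n) (⟦ q ⟧ n)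

  scale-eval : ∀ a q n → ⟦ List.map (a *_) q ⟧ n ≡ a * ⟦ q ⟧ n
  scale-eval a []      n = sym (*-zeroʳ a)
  scale-eval a (b ∷ q) n rewrite scale-eval a q n =
    solve 4 (λ a b n x → a :* b :+ n :* (a :* x) := a :* (b :+ n :* x)) refl a b n (⟦ q ⟧ n)

  ⊗-eval : ∀ p q n → ⟦ p ⊗ q ⟧ n ≡ ⟦ p ⟧ n * ⟦ q ⟧ n
  ⊗-eval []      q n = refl
  ⊗-eval (a ∷ p) q n rewrite ⊕-eval (List.map (a *_) q) (0 ∷ p ⊗ q) n | scale-eval a q n | ⊗-eval p q n =
    solve 4 (λ a n x y → a :* y :+ n :* (x :* y) := (a :+ n :* x) :* y) refl a n (⟦ p ⟧ n) (⟦ q ⟧ n)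

⊚-eval : ∀ p q n → ⟦ p ⊚ q ⟧ n ≡ ⟦ p ⟧ (⟦ q ⟧ n)
⊚-eval []      q n = refl
⊚-eval (a ∷ p) q n rewrite ⊕-eval (a ∷ []) (q ⊗ (p ⊚ q)) n | ⊗-eval q (p ⊚ q) n | ⊚-eval p q n | *-zeroʳ n
  | +-identityʳ a = refl

X-eval : ∀ n → ⟦ X ⟧ n ≡ n
X-eval n rewrite *-zeroʳ n | *-identityʳ n = refl

const-eval : ∀ a n → ⟦ a ∷ [] ⟧ n ≡ a
const-eval a n rewrite *-zeroʳ n = +-identityʳ a

⟦⟧-mono : ∀ p {m n} → m ≤ n → ⟦ p ⟧ m ≤ ⟦ p ⟧ n
⟦⟧-mono []      le = z≤n
⟦⟧-mono (a ∷ p) le = +-monoʳ-≤ a (*-mono-≤ le (⟦⟧-mono p le))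

⨾-eval : ∀ p q a n → ⟦ p ⊕ q ⊚ ((a ∷ []) ⊕ X) ⟧ n ≡ ⟦ p ⟧ n + ⟦ q ⟧ (a + n)
⨾-eval p q a n = trans (⊕-eval p (q ⊚ ((a ∷ []) ⊕ X)) n) (cong (⟦ p ⟧ n +_) (trans (⊚-eval q ((a ∷ []) ⊕ X) n)
  (cong ⟦ q ⟧ (trans (⊕-eval (a ∷ []) X n) (cong₂ _+_ (const-eval a n) (X-eval n))))))

pop-eval : ∀ p q n → ⟦ (1 ∷ []) ⊕ (p ⊕ q) ⟧ n ≡ 1 + (⟦ p ⟧ n + ⟦ q ⟧ n)
pop-eval p q n = trans (⊕-eval (1 ∷ []) (p ⊕ q) n) (cong₂ _+_ (const-eval 1 n) (⊕-eval p q n))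

for-eval : ∀ p n → ⟦ (1 ∷ []) ⊕ X ⊗ ((1 ∷ []) ⊕ p) ⟧ n ≡ 1 + n * (1 + ⟦ p ⟧ n)
for-eval p n = trans (⊕-eval (1 ∷ []) (X ⊗ ((1 ∷ []) ⊕ p)) n) (cong₂ _+_ (const-eval 1 n)
  (trans (⊗-eval X ((1 ∷ []) ⊕ p) n) (cong₂ _*_ (X-eval n) (trans (⊕-eval (1 ∷ []) p n) (cong (_+ ⟦ p ⟧ n) (const-eval 1 n))))))

-- Both the argument of the time bounds and the quantity that an iteration of a loop must not
-- increase.
core : ∀ {k} → (Fin k → Bool) → Vec Word k → ℕ
core free []      = 0
core free (w ∷ s) = (if free zero then 0 else length w) + core (free ∘ suc) s

size : ∀ {k} → Vec Word k → ℕ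
size = core (λ _ → false)

core-free : ∀ {k} free (s : Vec Word k) i f → free i ≡ true → core free (s [ i ]%= f) ≡ core free s
core-free free (w ∷ s) zero    f e rewrite e = refl
core-free free (w ∷ s) (suc i) f e = cong ((if free zero then 0 else length w) +_) (core-free (free ∘ suc) s i f e)

core-≔ : ∀ {k} free (s : Vec Word k) i f → free i ≡ false →
  length (lookup s i) + core free (s [ i ]%= f) ≡ length (f (lookup s i)) + core free s
core-≔ free (w ∷ s) zero    f e rewrite e =
  solve 3 (λ a b c → a :+ (b :+ c) := b :+ (a :+ c)) refl (length w) (length (f w)) (core (free ∘ suc) s)
core-≔ free (w ∷ s) (suc i) f e = begin
  l + (a + c′)  ≡⟨ solve 3 (λ l a c → l :+ (a :+ c) := a :+ (l :+ c)) refl l a c′ ⟩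
  a + (l + c′)  ≡⟨ cong (a +_) (core-≔ (free ∘ suc) s i f e) ⟩
  a + (m + c)   ≡⟨ solve 3 (λ l a c → l :+ (a :+ c) := a :+ (l :+ c)) refl a m c ⟩
  m + (a + c)   ∎
  where
  open ≡-Reasoning
  a l m c c′ : ℕ
  a = if free zero then 0 else length w
  l = length (lookup s i)
  m = length (f (lookup s i))
  c = core (free ∘ suc) s
  c′ = core (free ∘ suc) (s [ i ]%= f)

core≤size : ∀ {k} free (s : Vec Word k) → core free s ≤ size s
core≤size free [] = z≤n
core≤size free (w ∷ s) with free zero
... | false = +-monoʳ-≤ (length w) (core≤size (free ∘ suc) s)
... | true = ≤-trans (core≤size (free ∘ suc) s) (m≤n+m _ (length w))

height≤core : ∀ {k} free (s : Vec Word k) i → free i ≡ false → length (lookup s i) ≤ core free s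
height≤core free (w ∷ s) zero    e rewrite e = m≤m+n (length w) _
height≤core free (w ∷ s) (suc i) e = ≤-trans (height≤core (free ∘ suc) s i e) (m≤n+m _ _)

core-pop : ∀ {k} free (s : Vec Word k) i {b w} → free i ≡ false → lookup s i ≡ b ∷ w →
  suc (core free (s [ i ]≔ w)) ≡ core free s
core-pop free s i {b} {w} e eq = +-cancelˡ-≡ (length w) _ _ (begin
  length w + suc c  ≡⟨ +-suc (length w) c ⟩
  suc (length w) + c ≡⟨ cong (λ v → length v + c) (sym eq) ⟩
  length (lookup s i) + c ≡⟨ core-≔ free s i (const w) e ⟩
  length w + core free s ∎)
  where
  open ≡-Reasoning
  c : ℕ
  c = core free (s [ i ]≔ w)

core-pop-≤ : ∀ {k} free (s : Vec Word k) i {b w} → lookup s i ≡ b ∷ w → core free (s [ i ]≔ w) ≤ core free s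
core-pop-≤ free s i eq with free i in e
... | true  = ≤-reflexive (core-free free s i _ e)
... | false = ≤-trans (n≤1+n _) (≤-reflexive (core-pop free s i e eq))

core-push : ∀ {k} free (s : Vec Word k) i w → free i ≡ false → core free (s [ i ]%= (w ʳ++_)) ≡ length w + core free s
core-push free s i w e = +-cancelˡ-≡ (length (lookup s i)) _ _ (begin
  l + core free (s [ i ]%= (w ʳ++_)) ≡⟨ core-≔ free s i (w ʳ++_) e ⟩
  length (w ʳ++ lookup s i) + core free s ≡⟨ cong (_+ core free s) (length-ʳ++ w) ⟩
  length w + l + core free s ≡⟨ solve 3 (λ a b c → a :+ b :+ c := b :+ (a :+ c)) refl (length w) l (core free s) ⟩
  l + (length w + core free s) ∎)
  where
  open ≡-Reasoning
  l : ℕ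
  l = length (lookup s i)

-- A static criterion for polynomial cost

-- An upper bound on the net increase of `core`. A successful pop from a counted stack pays for one
-- pushed letter. A tame loop contributes nothing: each iteration pops one letter, and its body adds
-- at most one.
grow : ∀ {n} → (Fin (suc n) → Bool) → Prog n → ℕ
grow free (push i w)  = if free i then 0 else length w
grow free (p ⨾ q)     = grow free p + grow free q
grow free (pop i p e) = (if free i then grow free (p false) ⊔ grow free (p true) else ((grow free (p false) ⊔ grow free (p true)) ∸ 1)) ⊔ grow free e
grow free (for i p)   = 0

-- The stacks in `free` may grow without restriction, but loops only run over the others,
-- whose total height no iteration increases.
tame : ∀ {n} → (Fin (suc n) → Bool) → Prog n → Bool
tame free (push i w)  = true
tame free (p ⨾ q)     = tame free p ∧ tame free q
tame free (pop i p e) = (tame free (p false) ∧ tame free (p true)) ∧ tame free e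
tame free (for i p)   = not (free i) ∧ (((grow free (p false) ≤ᵇ 1) ∧ (grow free (p true) ≤ᵇ 1)) ∧ (tame free (p false) ∧ tame free (p true)))

T-not : ∀ {b} → T (not b) → b ≡ false
T-not {false} _ = refl

module _ {n} (free : Fin (suc n) → Bool) where

  loop-grow : ∀ m i f → free i ≡ false → (∀ b s → core free (f b s) ≤ 1 + core free s) →
    ∀ s → core free (loop m i f s) ≤ core free s
  loop-grow zero    i f e h s = ≤-refl
  loop-grow (suc m) i f e h s with lookup s i in eq
  ... | []    = ≤-refl
  ... | b ∷ w = ≤-trans (loop-grow m i f e h _) (≤-trans (h b _) (≤-reflexive (core-pop free s i e eq)))

  core-grow : ∀ p → T (tame free p) → ∀ s → core free (eval p s) ≤ grow free p + core free s
  core-grow (push i w) t s with free i in e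
  ... | true  = ≤-reflexive (core-free free s i _ e)
  ... | false = ≤-reflexive (core-push free s i w e)
  core-grow (p ⨾ q) t s with tp , tq ← ∧-T {tame free p} t = begin
    core free (eval q (eval p s))               ≤⟨ core-grow q tq _ ⟩
    grow free q + core free (eval p s)          ≤⟨ +-monoʳ-≤ (grow free q) (core-grow p tp s) ⟩
    grow free q + (grow free p + core free s)   ≡⟨ sym (+-assoc (grow free q) _ _) ⟩
    grow free q + grow free p + core free s     ≡⟨ cong (_+ core free s) (+-comm (grow free q) _) ⟩
    grow free p + grow free q + core free s     ∎
    where open ≤-Reasoning
  core-grow (pop i p e) t s with tp , te ← ∧-T {tame free (p false) ∧ tame free (p true)} t with lookup s i in eq
  ... | [] = ≤-trans (core-grow e te s) (+-monoˡ-≤ _ (m≤n⊔m _ (grow free e)))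
  ... | b ∷ w = ≤-trans (core-grow (p b) (∧-bool (tame free ∘ p) tp b) _)
        (≤-trans body (+-monoˡ-≤ (core free s) (m≤m⊔n _ (grow free e))))
    where
    g : ℕ
    g = grow free (p false) ⊔ grow free (p true)
    le : ∀ b → grow free (p b) ≤ g
    le = both _ (m≤m⊔n _ _) (m≤n⊔m (grow free (p false)) _)
    body : grow free (p b) + core free (s [ i ]≔ w) ≤ (if free i then g else (g ∸ 1)) + core free s
    body with free i in ei
    ... | true  = +-mono-≤ (le b) (core-pop-≤ free s i eq)
    ... | false = ≤-trans (+-monoˡ-≤ _ (le b)) (pred-≤ g (core-pop free s i ei eq))
      where
      pred-≤ : ∀ g {c d} → suc c ≡ d → g + c ≤ (g ∸ 1) + d
      pred-≤ zero    refl = n≤1+n _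
      pred-≤ (suc g) refl = ≤-reflexive (sym (+-suc g _))
  core-grow (for i p) t s with t₁ , t₂ ← ∧-T {not (free i)} t
    with t₃ , t₄ ← ∧-T {(grow free (p false) ≤ᵇ 1) ∧ (grow free (p true) ≤ᵇ 1)} t₂ =
    loop-grow (length (lookup s i)) i (λ b → eval (p b)) (T-not t₁) (λ b s → ≤-trans (core-grow (p b) (∧-bool (tame free ∘ p) t₄ b) s)
      (+-monoˡ-≤ _ (≤ᵇ⇒≤ _ 1 (∧-bool (λ b → grow free (p b) ≤ᵇ 1) t₃ b)))) s

  -- In a tame loop the value of `core` at the start bounds the number of iterations as well as
  -- `core` before each of them, whence a product. In a sequence the second program starts with
  -- `core` larger by at most `grow` of the first, whence the shifted argument. The two branches for
  -- a popped bit are added in place of a maximum.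
  bound : Prog n → Polynomial
  bound (push i w)  = pushCost w ∷ []
  bound (p ⨾ q)     = bound p ⊕ bound q ⊚ ((grow free p ∷ []) ⊕ X)
  bound (pop i p e) = (1 ∷ []) ⊕ (bound (p false) ⊕ bound (p true) ⊕ bound e)
  bound (for i p)   = (1 ∷ []) ⊕ X ⊗ ((1 ∷ []) ⊕ (bound (p false) ⊕ bound (p true)))

  loopCost-≤ : ∀ m i f c C → free i ≡ false → (∀ b s → core free (f b s) ≤ 1 + core free s) → ∀ S →
    (∀ b s → core free s ≤ S → c b s ≤ C) →
    ∀ s → core free s ≤ S → loopCost m i f c s ≤ 1 + m * (1 + C)
  loopCost-≤ zero    i f c C e h S hc s le = ≤-refl
  loopCost-≤ (suc m) i f c C e h S hc s le with lookup s i in eq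
  ... | []    = s≤s z≤n
  ... | b ∷ w = s≤s (≤-trans (+-mono-≤ (hc b s′ le′) (loopCost-≤ m i f c C e h S hc (f b s′) le″)) (≤-reflexive (+-suc C _)))
    where
    s′ : Stacks n
    s′ = s [ i ]≔ w
    le′ : core free s′ ≤ S
    le′ = ≤-trans (core-pop-≤ free s i eq) le
    le″ : core free (f b s′) ≤ S
    le″ = ≤-trans (h b s′) (≤-trans (≤-reflexive (core-pop free s i e eq)) le)

  summand : ∀ (p : Bool → Polynomial) b N → ⟦ p b ⟧ N ≤ ⟦ p false ⊕ p true ⟧ N
  summand p b N rewrite ⊕-eval (p false) (p true) N = both (λ b → ⟦ p b ⟧ N ≤ ⟦ p false ⟧ N + ⟦ p true ⟧ N) (m≤m+n _ _) (m≤n+m _ _) b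

  cost-≤ : ∀ p → T (tame free p) → ∀ s → cost p s ≤ ⟦ bound p ⟧ (core free s)
  cost-≤ (push i w) t s = ≤-reflexive (sym (const-eval _ (core free s)))
  cost-≤ (p ⨾ q) t s with tp , tq ← ∧-T {tame free p} t
    = ≤-trans (+-mono-≤ (cost-≤ p tp s) (≤-trans (cost-≤ q tq _) (⟦⟧-mono (bound q) (core-grow p tp s))))
        (≤-reflexive (sym (⨾-eval (bound p) (bound q) (grow free p) (core free s))))
  cost-≤ (pop i p e) t s with tp , te ← ∧-T {tame free (p false) ∧ tame free (p true)} t
    with lookup s i in eq
  ... | [] = ≤-trans (s≤s (≤-trans (cost-≤ e te s) (m≤n+m _ (⟦ bound (p false) ⊕ bound (p true) ⟧ (core free s))))) (≤-reflexive (sym (pop-eval (bound (p false) ⊕ bound (p true)) (bound e) (core free s))))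
  ... | b ∷ w = ≤-trans (s≤s (≤-trans (cost-≤ (p b) (∧-bool (tame free ∘ p) tp b) _)
        (≤-trans (⟦⟧-mono (bound (p b)) (core-pop-≤ free s i eq))
          (≤-trans (summand (bound ∘ p) b (core free s)) (m≤m+n _ (⟦ bound e ⟧ (core free s)))))))
        (≤-reflexive (sym (pop-eval (bound (p false) ⊕ bound (p true)) (bound e) (core free s))))
  cost-≤ (for i p) t s with t₁ , t₂ ← ∧-T {not (free i)} t
    with t₃ , t₄ ← ∧-T {(grow free (p false) ≤ᵇ 1) ∧ (grow free (p true) ≤ᵇ 1)} t₂
    = ≤-trans (loopCost-≤ (length (lookup s i)) i (λ b → eval (p b)) (λ b → cost (p b)) (⟦ bound (p false) ⊕ bound (p true) ⟧ (core free s)) (T-not t₁)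
         (λ b s → ≤-trans (core-grow (p b) (∧-bool (tame free ∘ p) t₄ b) s)
            (+-monoˡ-≤ _ (≤ᵇ⇒≤ _ 1 (∧-bool (λ b → grow free (p b) ≤ᵇ 1) t₃ b))))
         (core free s)
         (λ b s′ le → ≤-trans (cost-≤ (p b) (∧-bool (tame free ∘ p) t₄ b) s′)
            (≤-trans (⟦⟧-mono (bound (p b)) le) (summand (bound ∘ p) b (core free s))))
         s ≤-refl)
      (≤-trans (s≤s (*-monoˡ-≤ _ (height≤core free s i (T-not t₁))))
        (≤-reflexive (sym (for-eval (bound (p false) ⊕ bound (p true)) (core free s)))))

-- Composition of efficient programs

loop-size : ∀ {n} m (i : Fin (suc n)) f c → (∀ b s → size (f b s) ≤ c b s + size s) →
  ∀ s → size (loop m i f s) ≤ loopCost m i f c s + size s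
loop-size zero    i f c h s = n≤1+n _
loop-size (suc m) i f c h s with lookup s i in eq
... | []    = n≤1+n _
... | b ∷ w = begin
  size (loop m i f (f b s′))      ≤⟨ loop-size m i f c h (f b s′) ⟩
  l + size (f b s′)               ≤⟨ +-monoʳ-≤ l (h b s′) ⟩
  l + (c b s′ + size s′)          ≤⟨ +-monoʳ-≤ l (+-monoʳ-≤ (c b s′) (core-pop-≤ (λ _ → false) s i eq)) ⟩
  l + (c b s′ + size s)           ≡⟨ sym (+-assoc l _ _) ⟩
  l + c b s′ + size s             ≡⟨ cong (_+ size s) (+-comm l _) ⟩
  c b s′ + l + size s             ≤⟨ n≤1+n _ ⟩
  suc (c b s′ + l + size s)       ∎
  where
  open ≤-Reasoning
  s′ = s [ i ]≔ w
  l : ℕ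
  l = loopCost m i f c (f b s′)

-- Every pushed letter has been paid for by at least one step. This bounds the input of a second
-- program, whatever stacks are free in the first.
eval-size : ∀ {n} (p : Prog n) s → size (eval p s) ≤ cost p s + size s
eval-size (push i w) s = ≤-trans (≤-reflexive (core-push (λ _ → false) s i w refl)) (+-monoˡ-≤ _ (length≤pushCost w))
  where
  length≤pushCost : ∀ w → length w ≤ pushCost w
  length≤pushCost []      = z≤n
  length≤pushCost (b ∷ w) = s≤s (≤-trans (length≤pushCost w) (n≤1+n _))
eval-size (p ⨾ q) s = begin
  size (eval q (eval p s))               ≤⟨ eval-size q _ ⟩
  cost q (eval p s) + size (eval p s)    ≤⟨ +-monoʳ-≤ _ (eval-size p s) ⟩
  cost q (eval p s) + (cost p s + size s) ≡⟨ sym (+-assoc (cost q (eval p s)) _ _) ⟩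
  cost q (eval p s) + cost p s + size s  ≡⟨ cong (_+ size s) (+-comm (cost q (eval p s)) _) ⟩
  cost p s + cost q (eval p s) + size s  ∎
  where open ≤-Reasoning
eval-size (pop i p e) s with lookup s i in eq
... | []    = ≤-trans (eval-size e s) (n≤1+n _)
... | b ∷ w = ≤-trans (eval-size (p b) _) (≤-trans (+-monoʳ-≤ (cost (p b) (s [ i ]≔ w)) (core-pop-≤ (λ _ → false) s i eq)) (n≤1+n _))
eval-size (for i p) s = loop-size (length (lookup s i)) i (λ b → eval (p b)) (λ b → cost (p b)) (λ b s → eval-size (p b) s) s

-- The bound refers to the height of all stacks, so parts that are tame for different choices of
-- free stacks can be combined: a stack may grow freely in one part and drive a loop in the next.
Efficient : ∀ {n} → Prog n → Set
Efficient p = T (wf p) × ∃[ q ] ∀ s → cost p s ≤ ⟦ q ⟧ (size s)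

tame-efficient : ∀ {n} free (p : Prog n) → T (wf p ∧ tame free p) → Efficient p
tame-efficient free p ok with w , t ← ∧-T {wf p} ok =
  w , bound free p , λ s → ≤-trans (cost-≤ free p t s) (⟦⟧-mono (bound free p) (core≤size free s))

T-∧ : ∀ {a b} → T a → T b → T (a ∧ b)
T-∧ {true} _ t = t

⨾-efficient : ∀ {n} {p q : Prog n} → Efficient p → Efficient q → Efficient (p ⨾ q)
⨾-efficient {p = p} {q} (wp , P , hp) (wq , Q , hq) = T-∧ {wf p} wp wq , P ⊕ Q ⊚ (P ⊕ X) , λ s → begin
  cost p s + cost q (eval p s)         ≤⟨ +-mono-≤ (hp s) (≤-trans (hq (eval p s)) (⟦⟧-mono Q (≤-trans (eval-size p s) (+-monoˡ-≤ (size s) (hp s))))) ⟩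
  ⟦ P ⟧ (size s) + ⟦ Q ⟧ (⟦ P ⟧ (size s) + size s) ≡⟨ sym (eq (size s)) ⟩
  ⟦ P ⊕ Q ⊚ (P ⊕ X) ⟧ (size s) ∎
  where
  open ≤-Reasoning
  eq : ∀ S → ⟦ P ⊕ Q ⊚ (P ⊕ X) ⟧ S ≡ ⟦ P ⟧ S + ⟦ Q ⟧ (⟦ P ⟧ S + S)
  eq S rewrite ⊕-eval P (Q ⊚ (P ⊕ X)) S | ⊚-eval Q (P ⊕ X) S | ⊕-eval P X S | X-eval S = refl

size-empty : ∀ n → size (Vec.replicate n []) ≡ 0
size-empty zero    = refl
size-empty (suc n) = size-empty n

efficient⇒computable : ∀ {n} (p : Prog n) → Efficient p → PolyTimeComputable (λ x → Vec.head (eval p (x ∷ Vec.replicate n [])))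
efficient⇒computable {n} p (w , q , h) = computes p w q λ x →
  ≤-trans (h _) (≤-reflexive (cong ⟦ q ⟧ (trans (cong (length x +_) (size-empty n)) (+-identityʳ _))))

computable-≗ : ∀ {f g} → PolyTimeComputable f → (∀ x → f x ≡ g x) → PolyTimeComputable g
computable-≗ (M , det , time , out) eq = M , det , time , λ x → subst (Outputs M x) (eq x) (out x)

-- Guessing a word as long as the input

-- The input, reversed by being read, sits on stack 2 and the guess on stack 8. All other stacks are
-- empty, in particular stack 0, whose emptiness at the end means acceptance.
guessed : Word → Word → Stacks 11
guessed v w = [] ∷ [] ∷ v ∷ [] ∷ [] ∷ [] ∷ [] ∷ [] ∷ w ∷ [] ∷ [] ∷ [] ∷ []

AcceptsGuess : Prog 11 → Word → Word → Set
AcceptsGuess p v w = Vec.head (eval p (guessed v w)) ≡ []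

module GuessMachine (p : Prog 11) where

  -- Acceptance depends on the state alone, while the verdict of `p` is on a tape; `check` turns one
  -- into the other.
  data Phase : Set where
    guess check accept : Phase

  finite-Phase : Finite Phase
  finite-Phase = record
    { card = 3
    ; enc = λ { guess → # 0 ; check → # 1 ; accept → # 2 }
    ; dec = λ { zero → guess ; (suc zero) → check ; (suc (suc _)) → accept }
    ; dec-enc = λ { guess → refl ; check → refl ; accept → refl } }

  F : Finite (Pos p ⊎ Phase)
  F = finite-⊎ (finite-Pos p) finite-Phase

  open Finite F using () renaming (card to states; enc to state; dec to phase; dec-enc to phase-state)

  acts : Symbol 0 × Move → Symbol 0 × Move → Symbol 0 × Move → Actions 11
  acts a b c = a ∷ i ∷ b ∷ i ∷ i ∷ i ∷ i ∷ i ∷ c ∷ i ∷ i ∷ i ∷ []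
    where
    i : Symbol 0 × Move
    i = blank , stay

  guessAction : Bool → Bool → Fin states × Actions 11
  guessAction b g = state (inj₂ guess) , acts (blank , moveR) (bit b , moveL) (bit g , moveL)

  guessMoves : Symbol 0 → List (Fin states × Actions 11)
  guessMoves (bit b) = guessAction b false ∷ guessAction b true ∷ []
  guessMoves _       = [ state (inj₁ (entry p)) , acts (blank , stay) (blank , moveR) (blank , moveR) ]

  checkMoves : Symbol 0 → Vec (Symbol 0) 12 → List (Fin states × Actions 11)
  checkMoves (bit b) ss = []
  checkMoves _       ss = [ state (inj₂ accept) , idle ss ]

  move : Pos p ⊎ Phase → Vec (Symbol 0) 12 → List (Fin states × Actions 11)
  move (inj₁ pos)    ss       = [ step′ p (state ∘ inj₁) (state (inj₂ check)) pos ss ]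
  move (inj₂ guess)  (s ∷ ss) = guessMoves s
  move (inj₂ check)  (s ∷ ss) = checkMoves s (s ∷ ss)
  move (inj₂ accept) ss       = []

  accepting : Pos p ⊎ Phase → Bool
  accepting (inj₂ accept) = true
  accepting _             = false

  open Simulation {11} (state (inj₂ guess)) (accepting ∘ phase) (λ q → move (phase q)) public

  move-enc : ∀ a ss → move (phase (state a)) ss ≡ move a ss
  move-enc a ss = cong (λ a → move a ss) (phase-state a)

  unread : List (Symbol 0) → Word → Tape 0
  unread ls []      = tape ls blank []
  unread ls (b ∷ y) = tape ls (bit b) (List.map bit y)

  written : Word → Tape 0
  written w = tape [] blank (List.map bit w)

  tapes-guess : Tape 0 → Word → Word → Tapes
  tapes-guess t v w = t ∷ e ∷ written v ∷ e ∷ e ∷ e ∷ e ∷ e ∷ written w ∷ e ∷ e ∷ e ∷ []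
    where
    e : Tape 0
    e = tape [] blank []

  config-guess : List (Symbol 0) → Word → Word → Word → Config M
  config-guess ls y v w = config (state (inj₂ guess)) (tapes-guess (unread ls y) v w)

  initial≡guess : ∀ x → initial M x ≡ config-guess [] x [] []
  initial≡guess []      = refl
  initial≡guess (b ∷ x) = refl

  unread-next : ∀ ls y → shift moveR (tape ls blank (List.map bit y)) ≡ unread (blank ∷ ls) y
  unread-next ls []      = refl
  unread-next ls (b ∷ y) = refl

  guess-step : ∀ ls b y v w g →
    apply M (guessAction b g) (config-guess ls (b ∷ y) v w)
    ≡ config-guess (blank ∷ ls) y (b ∷ v) (g ∷ w)
  guess-step ls b y v w g = cong (λ t → config (state (inj₂ guess)) (tapes-guess t (b ∷ v) (g ∷ w))) (unread-next ls y)

  stack-written : ∀ w → stack (shift moveR (written w)) ≡ w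
  stack-written []      = refl
  stack-written (b ∷ w) = cong (b ∷_) (leadingBits-map w)

  start-run : ∀ ls v w → ∃[ ts ] DRuns M 1 (config-guess ls [] v w) (config (state (inj₁ (entry p))) ts) × stacks ts ≡ guessed v w
  start-run ls v w = _ , step _ (move-enc (inj₂ guess) _) done ,
    cong₂ (λ v w → [] ∷ [] ∷ v ∷ [] ∷ [] ∷ [] ∷ [] ∷ [] ∷ w ∷ [] ∷ [] ∷ [] ∷ []) (stack-written v) (stack-written w)

  check-tapes : ∀ ts → (Good M (config (state (inj₂ check)) ts) ⇔ Vec.head (stacks ts) ≡ [])
                       × Terminates M (config (state (inj₂ check)) ts) 1
  check-tapes (tape ls (bit b) rs ∷ ts) =
    mk⇔ (λ { (_ , _ , done , _ , a) → absurd (trans (sym (cong accepting (phase-state (inj₂ check)))) a)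
           ; (_ , _ , step a a∈ r , _) → absurd′ (subst (a ∈ˡ_) (move-enc (inj₂ check) _) a∈) })
        (λ ())
    , λ r → ≤-trans (halted-terminates (move-enc (inj₂ check) _) r) z≤n
    where
    absurd : ∀ {A : Set} → false ≡ true → A
    absurd ()
    absurd′ : ∀ {A B : Set} {a : B} → a ∈ˡ [] → A
    absurd′ ()
  check-tapes (tape ls blank rs ∷ ts) =
    mk⇔ (λ _ → refl) (λ _ → drun-good run (0 , _ , done , halted , cong accepting (phase-state (inj₂ accept))))
    , λ r → drun-terminates run (halted-terminates halted) r
    where
    end : Tapes
    end = zipWith writeAndMove (idle (Vec.map head (tape ls blank rs ∷ ts))) (tape ls blank rs ∷ ts)
    halted : Halted M (config (state (inj₂ accept)) end)
    halted = move-enc (inj₂ accept) (Vec.map head end)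
    run : DRuns M 1 (config (state (inj₂ check)) (tape ls blank rs ∷ ts)) (config (state (inj₂ accept)) end)
    run = step _ (move-enc (inj₂ check) _) done

  module _ (ok : T (wf p)) where

    run : ∀ ls v w → ∃[ ts ] DRuns M (1 + cost p (guessed v w)) (config-guess ls [] v w) (config (state (inj₂ check)) ts)
                           × stacks ts ≡ eval p (guessed v w)
    run ls v w with start-run ls v w
    ... | ts , r , e with subst (λ s → Reaches (cost p s) (state (inj₁ (entry p))) ts (state (inj₂ check)) (eval p s)) e
                            (sim p ok (state ∘ inj₁) (state (inj₂ check)) (λ pos ss → move-enc (inj₁ pos) ss) ts)
    ... | ts′ , r′ , e′ = ts′ , drun-++ r r′ , e′

    -- Generalised over the letters already read, `v`, and already guessed, `w`, so that induction
    -- on the unread input applies.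
    good-guess : ∀ y ls v w → Good M (config-guess ls y v w) ⇔
      (∃[ u ] length u ≡ length y × AcceptsGuess p (y ʳ++ v) (u ʳ++ w))
    good-guess [] ls v w with run ls v w
    ... | ts , r , e = mk⇔
      (λ g → [] , refl , trans (cong Vec.head (sym e)) (Equivalence.to (proj₁ (check-tapes ts)) (good-drun r g)))
      λ { ([] , _ , a) → drun-good r (Equivalence.from (proj₁ (check-tapes ts)) (trans (cong Vec.head e) a)) }
    good-guess (b ∷ y) ls v w = mk⇔ to from
      where
      next : Bool → Config M
      next g = config-guess (blank ∷ ls) y (b ∷ v) (g ∷ w)
      to : Good M (config-guess ls (b ∷ y) v w) → ∃[ u ] length u ≡ suc (length y) × AcceptsGuess p (y ʳ++ (b ∷ v)) (u ʳ++ w)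
      to (_ , _ , done , h , _) with () ← trans (sym (move-enc (inj₂ guess) _)) h
      to (_ , _ , step a a∈ r , h , acc) with subst (a ∈ˡ_) (move-enc (inj₂ guess) _) a∈
      ... | here refl with Equivalence.to (good-guess y (blank ∷ ls) (b ∷ v) (false ∷ w)) (subst (Good M) (guess-step ls b y v w false) (_ , _ , r , h , acc))
      ...   | u , l , g = false ∷ u , cong suc l , g
      to (_ , _ , step a a∈ r , h , acc) | there (here refl) with Equivalence.to (good-guess y (blank ∷ ls) (b ∷ v) (true ∷ w)) (subst (Good M) (guess-step ls b y v w true) (_ , _ , r , h , acc))
      ...   | u , l , g = true ∷ u , cong suc l , g
      from : (∃[ u ] length u ≡ suc (length y) × AcceptsGuess p (y ʳ++ (b ∷ v)) (u ʳ++ w)) → Good M (config-guess ls (b ∷ y) v w)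
      from (false ∷ u , l , a) with subst (Good M) (sym (guess-step ls b y v w false)) (Equivalence.from (good-guess y (blank ∷ ls) (b ∷ v) (false ∷ w)) (u , suc-injective l , a))
      ... | _ , _ , r , h , acc = _ , _ , step (guessAction b false) (subst (guessAction b false ∈ˡ_) (sym (move-enc (inj₂ guess) (Vec.map head (tapes-guess (unread ls (b ∷ y)) v w)))) (here refl)) r , h , acc
      from (true ∷ u , l , a) with subst (Good M) (sym (guess-step ls b y v w true)) (Equivalence.from (good-guess y (blank ∷ ls) (b ∷ v) (true ∷ w)) (u , suc-injective l , a))
      ... | _ , _ , r , h , acc = _ , _ , step (guessAction b true) (subst (guessAction b true ∈ˡ_) (sym (move-enc (inj₂ guess) (Vec.map head (tapes-guess (unread ls (b ∷ y)) v w)))) (there (here refl))) r , h , acc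

    -- The 2 counts the step that enters `p` and the step of the final check. The two equations on
    -- lengths are invariant under reading a letter.
    guess-terminates : ∀ N C → (∀ v w → length v ≡ N → length w ≡ N → cost p (guessed v w) ≤ C) →
      ∀ y ls v w → length y + length v ≡ N → length y + length w ≡ N →
      Terminates M (config-guess ls y v w) (length y + (2 + C))
    guess-terminates N C h [] ls v w lv lw r with run ls v w
    ... | ts , r′ , e = ≤-trans (drun-terminates r′ (proj₂ (check-tapes ts)) r)
      (s≤s (≤-trans (+-monoˡ-≤ 1 (h v w lv lw)) (≤-reflexive (+-comm C 1))))
    guess-terminates N C h (b ∷ y) ls v w lv lw done = z≤n
    guess-terminates N C h (b ∷ y) ls v w lv lw (step {t = t} {d = d} a a∈ r) with subst (a ∈ˡ_) (move-enc (inj₂ guess) _) a∈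
    ... | here refl = s≤s (guess-terminates N C h y (blank ∷ ls) (b ∷ v) (false ∷ w)
            (trans (+-suc (length y) _) lv) (trans (+-suc (length y) _) lw) (subst (λ c → Runs M t c d) (guess-step ls b y v w false) r))
    ... | there (here refl) = s≤s (guess-terminates N C h y (blank ∷ ls) (b ∷ v) (true ∷ w)
            (trans (+-suc (length y) _) lv) (trans (+-suc (length y) _) lw) (subst (λ c → Runs M t c d) (guess-step ls b y v w true) r))

-- One bit is guessed for each input letter read, so the input itself serves as the clock that ends
-- the guessing.
guess⇒NP : ∀ {p} → Efficient p → InNP (λ y → ∃[ w ] length w ≡ length y × AcceptsGuess p (reverse y) w)
guess⇒NP {p} (ok , q , h) = M , (time , terminates) , λ y → mk⇔ (to y) (from y)
  where
  open GuessMachine p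
  -- The bound `q` of the program is taken at twice the input length, because the program starts
  -- with two stacks of that height.
  time : Polynomial
  time = X ⊕ ((2 ∷ []) ⊕ q ⊚ (X ⊕ X))
  time-eval : ∀ n → ⟦ time ⟧ n ≡ n + (2 + ⟦ q ⟧ (n + n))
  time-eval n = trans (⊕-eval X ((2 ∷ []) ⊕ q ⊚ (X ⊕ X)) n) (cong₂ _+_ (X-eval n)
    (trans (⊕-eval (2 ∷ []) (q ⊚ (X ⊕ X)) n) (cong₂ _+_ (const-eval 2 n)
      (trans (⊚-eval q (X ⊕ X) n) (cong ⟦ q ⟧ (trans (⊕-eval X X n) (cong₂ _+_ (X-eval n) (X-eval n))))))))
  terminates : RunsInTime M time
  terminates y {t} {c} r = ≤-trans
    (guess-terminates ok (length y) _ bnd y [] [] [] (+-identityʳ _) (+-identityʳ _) (subst (λ c₀ → Runs M t c₀ c) (initial≡guess y) r))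
    (≤-reflexive (sym (time-eval (length y))))
    where
    bnd : ∀ v w → length v ≡ length y → length w ≡ length y → cost p (guessed v w) ≤ ⟦ q ⟧ (length y + length y)
    bnd v w lv lw = ≤-trans (h (guessed v w)) (≤-reflexive (cong ⟦ q ⟧ (cong₂ _+_ lv (trans (+-identityʳ _) lw))))
  to : ∀ y → (∃[ w ] length w ≡ length y × AcceptsGuess p (reverse y) w) → Accepts M y
  to y (w , l , a) = subst (Good M) (sym (initial≡guess y)) (Equivalence.from (good-guess ok y [] [] [])
    (reverse w , trans (length-reverse w) l , subst (AcceptsGuess p (reverse y)) (sym (reverse-involutive w)) a))
  from : ∀ y → Accepts M y → ∃[ w ] length w ≡ length y × AcceptsGuess p (reverse y) w
  from y g with Equivalence.to (good-guess ok y [] [] []) (subst (Good M) (initial≡guess y) g)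
  ... | u , l , a = reverse u , trans (length-reverse u) l , a

-- Gaps between the lengths of the members

tri : ℕ → ℕ
tri zero    = 0
tri (suc n) = suc n + tri n

paddedLength : ℕ → ℕ
paddedLength n = tri n + suc n

tri-mono : ∀ {m n} → m ≤ n → tri m ≤ tri n
tri-mono z≤n      = z≤n
tri-mono (s≤s le) = +-mono-≤ (s≤s le) (tri-mono le)

paddedLength-mono : ∀ {m n} → m ≤ n → paddedLength m ≤ paddedLength n
paddedLength-mono le = +-mono-≤ (tri-mono le) (s≤s le)

-- Consecutive values of `paddedLength` at `m` and `suc m` differ by `m + 2`; monotonicity reduces
-- the claim to this case.
paddedLength-gap : ∀ {m n} → paddedLength m < paddedLength n → m < n × paddedLength m + m < paddedLength n
paddedLength-gap {m} {n} lt = m<n , (begin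
  suc (tri m + suc m + m)       ≡⟨ cong suc (+-assoc (tri m) (suc m) m) ⟩
  suc (tri m + (suc m + m))     ≡⟨ cong (λ k → suc (tri m + k)) (+-comm (suc m) m) ⟩
  suc (tri m + (m + suc m))     ≤⟨ s≤s (+-monoʳ-≤ (tri m) (+-monoʳ-≤ m (n≤1+n (suc m)))) ⟩
  suc (tri m + (m + suc (suc m))) ≡⟨ cong suc (sym (+-assoc (tri m) m _)) ⟩
  suc (tri m + m + suc (suc m)) ≡⟨ cong (λ k → suc (k + suc (suc m))) (+-comm (tri m) m) ⟩
  paddedLength (suc m)          ≤⟨ paddedLength-mono m<n ⟩
  paddedLength n                ∎)
  where
  open ≤-Reasoning
  m<n : m < n
  m<n = ≰⇒> (λ n≤m → <⇒≱ lt (paddedLength-mono n≤m))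

-- Padding a member k times yields one of length paddedLength m with m ≥ k, and the next longer
-- member exceeds it by more than k.
gaps⇒¬paddable : ∀ {B} → (∀ {y} → y ∈ B → ∃[ n ] length y ≡ paddedLength n) → ∃[ y ] y ∈ B → ¬ TightPaddable B
gaps⇒¬paddable {B} len (y₀ , y₀∈) (σ , k , _ , pad) with far k
  where
  far : ∀ j → ∃[ y ] ∃[ n ] y ∈ B × length y ≡ paddedLength n × j ≤ n
  far zero with len y₀∈
  ... | n , e = y₀ , n , y₀∈ , e , z≤n
  far (suc j) with far j
  ... | y , n , y∈ , e , j≤n with pad y
  ... | iff , lt , _ with len (Equivalence.from iff y∈)
  ... | n′ , e′ = σ y , n′ , Equivalence.from iff y∈ , e′ ,
                  ≤-trans (s≤s j≤n) (proj₁ (paddedLength-gap (subst₂ _<_ e e′ lt)))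
... | y , n , y∈ , e , k≤n with pad y
... | iff , lt , le with len (Equivalence.from iff y∈)
... | n′ , e′ = <-irrefl refl (<-≤-trans (proj₂ (paddedLength-gap (subst₂ _<_ e e′ lt)))
      (≤-trans (subst₂ (λ a b → a ≤ b + k) e′ e le) (+-monoʳ-≤ (paddedLength n) k≤n)))

tightZ⇒tight : ∀ {B} → TightZPaddable B → TightPaddable B
tightZ⇒tight (σ , k , pad , _) = σ , k , pad

-- The polynomial-time example

emptyOnly-moves : Fin 2 → Vec (Symbol 0) 1 → List (Fin 2 × Vec (Symbol 0 × Move) 1)
emptyOnly-moves zero (blank ∷ []) = [ suc zero , (blank , stay) ∷ [] ]
emptyOnly-moves _    _            = []

emptyOnly : Machine
emptyOnly = record
  { states = 2 ; aux = 0 ; extraTapes = 0 ; start = zero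
  ; accept = λ { zero → false ; (suc _) → true } ; δ = emptyOnly-moves }

emptyOnly-inP : InP (_≡ [])
emptyOnly-inP = emptyOnly , det , (1 ∷ [] , time) , λ x → mk⇔ (λ { refl → 1 , _ , step _ (here refl) done , refl , refl }) (acc x)
  where
  det : Deterministic emptyOnly
  det zero (blank ∷ [])  = ≤-refl
  det zero (bit b ∷ [])  = z≤n
  det (suc q) s          = z≤n
  time : RunsInTime emptyOnly (1 ∷ [])
  time []      done                          = z≤n
  time []      (step _ (here refl) done)     = ≤-refl
  time []      (step _ (here refl) (step _ () _))
  time (b ∷ x) done                          = z≤n
  time (b ∷ x) (step _ () _)
  acc : ∀ x → Accepts emptyOnly x → x ≡ []
  acc []      _                       = refl
  acc (b ∷ x) (_ , _ , done , _ , ())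
  acc (b ∷ x) (_ , _ , step _ () _ , _)

emptyOnly-¬paddable : ¬ TightPaddable (_≡ [])
emptyOnly-¬paddable (σ , k , _ , pad) with pad []
... | iff , lt , _ with () ← subst (λ y → 0 < length y) (Equivalence.from iff refl) lt

-- Padding a word to a length of the form paddedLength n

zeros : ℕ → Word
zeros n = replicate n false

padded : Word → Word
padded x = zeros (tri (length x)) ++ true ∷ x

length-padded : ∀ x → length (padded x) ≡ paddedLength (length x)
length-padded x = trans (length-++ (zeros (tri (length x)))) (cong (_+ suc (length x)) (length-replicate _))

++-true-injective : ∀ m n {x y} → zeros m ++ true ∷ x ≡ zeros n ++ true ∷ y → x ≡ y
++-true-injective zero    zero    refl = refl
++-true-injective (suc m) (suc n) e    = ++-true-injective m n (∷-injectiveʳ e)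

padded-injective : ∀ {x y} → padded x ≡ padded y → x ≡ y
padded-injective {x} {y} = ++-true-injective (tri (length x)) (tri (length y))

skip : ∀ {n} → Prog n
skip = push zero []

iterate : ∀ {A : Set} → ℕ → (A → A) → A → A
iterate zero    f a = a
iterate (suc n) f a = iterate n f (f a)

iterate-+ : ∀ {A : Set} m n (f : A → A) a → iterate n f (iterate m f a) ≡ iterate (m + n) f a
iterate-+ zero    n f a = refl
iterate-+ (suc m) n f a = iterate-+ m n f (f a)

zeros-ʳ++ : ∀ m n → zeros m ʳ++ zeros n ≡ zeros (m + n)
zeros-ʳ++ zero    n = refl
zeros-ʳ++ (suc m) n = trans (zeros-ʳ++ m (suc n)) (cong zeros (+-suc m n))

-- The counter on stack 3 grows by one at each call, so that repeated calls run `act` once, twice, ….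
countUp : Prog 11 → Prog 11
countUp act = push (# 3) [ false ] ⨾ for (# 3) (λ _ → act ⨾ push (# 4) [ false ]) ⨾ for (# 4) (λ _ → push (# 3) [ false ])

triangle : Prog 11 → Prog 11
triangle act = for (# 2) (λ _ → countUp act)

-- Stack 0 and the stacks 5 to 11, on which a repeated action may work. Stacks 2 to 4 drive the
-- repetition, and stack 1 is carried along unchanged.
Rest : Set
Rest = Word × Vec Word 7

around : Rest → Word → Word → Word → Word → Stacks 11
around (h , v) x c t u = h ∷ x ∷ c ∷ t ∷ u ∷ v

module Triangle (act : Prog 11) (F : Rest → Rest)
  (act-F : ∀ a x c t u → eval act (around a x c t u) ≡ around (F a) x c t u) where

  count : ∀ k a x c u → eval (for (# 3) (λ _ → act ⨾ push (# 4) [ false ])) (around a x c (zeros k) u)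
                      ≡ around (iterate k F a) x c [] (zeros k ʳ++ u)
  count zero    a x c u = refl
  count (suc k) a x c u = trans
    (cong (λ s → loop (length (zeros k)) (# 3) (λ _ → eval (act ⨾ push (# 4) [ false ])) (eval (push (# 4) [ false ]) s)) (act-F a x c (zeros k) u))
    (count k (F a) x c (false ∷ u))

  restore : ∀ k a x c t → eval (for (# 4) (λ _ → push (# 3) [ false ])) (around a x c t (zeros k))
                        ≡ around a x c (zeros k ʳ++ t) []
  restore zero    a x c t = refl
  restore (suc k) a x c t = restore k a x c (false ∷ t)

  eval-countUp : ∀ k a x c → eval (countUp act) (around a x c (zeros k) []) ≡ around (iterate (suc k) F a) x c (zeros (suc k)) []
  eval-countUp k a x c = begin
    eval back (eval forth (around a x c (zeros (suc k)) []))
      ≡⟨ cong (eval back) (count (suc k) a x c []) ⟩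
    eval back (around (iterate (suc k) F a) x c [] (zeros (suc k) ʳ++ []))
      ≡⟨ cong (λ u → eval back (around (iterate (suc k) F a) x c [] u)) (trans (zeros-ʳ++ (suc k) 0) (cong zeros (+-identityʳ _))) ⟩
    eval back (around (iterate (suc k) F a) x c [] (zeros (suc k)))
      ≡⟨ restore (suc k) (iterate (suc k) F a) x c [] ⟩
    around (iterate (suc k) F a) x c (zeros (suc k) ʳ++ []) []
      ≡⟨ cong (λ t → around (iterate (suc k) F a) x c t []) (trans (zeros-ʳ++ (suc k) 0) (cong zeros (+-identityʳ _))) ⟩
    around (iterate (suc k) F a) x c (zeros (suc k)) [] ∎
    where
    open ≡-Reasoning
    forth back : Prog 11
    forth = for (# 3) (λ _ → act ⨾ push (# 4) [ false ])
    back  = for (# 4) (λ _ → push (# 3) [ false ])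

  -- Started with the counter at `k`, the action runs (k+1) + ... + (k+n) times for n = `length c`,
  -- which is `tri n + k * n`. The `m` runs already made are recorded so that induction on `c` goes
  -- through.
  eval-from : ∀ c k m a x →
    eval (triangle act) (around (iterate m F a) x c (zeros k) []) ≡ around (iterate (m + (tri (length c) + k * length c)) F a) x [] (zeros (length c + k)) []
  eval-from []      k m a x rewrite *-zeroʳ k | +-identityʳ m = refl
  eval-from (b ∷ c) k m a x = begin
    loop (length c) (# 2) (λ _ → eval (countUp act)) (eval (countUp act) (around (iterate m F a) x c (zeros k) []))
      ≡⟨ cong (loop (length c) (# 2) (λ _ → eval (countUp act))) (trans (eval-countUp k (iterate m F a) x c)
           (cong (λ a → around a x c (zeros (suc k)) []) (iterate-+ m (suc k) F a))) ⟩
    eval (triangle act) (around (iterate (m + suc k) F a) x c (zeros (suc k)) [])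
      ≡⟨ eval-from c (suc k) (m + suc k) a x ⟩
    around (iterate (m + suc k + (tri n + suc k * n)) F a) x [] (zeros (n + suc k)) []
      ≡⟨ cong₂ (λ i j → around (iterate i F a) x [] (zeros j) []) (arith m k n (tri n)) (+-suc n k) ⟩
    around (iterate (m + (tri (suc n) + k * suc n)) F a) x [] (zeros (suc n + k)) [] ∎
    where
    open ≡-Reasoning
    n : ℕ
    n = length c
    arith : ∀ m k n t → m + suc k + (t + suc k * n) ≡ m + (suc n + t + k * suc n)
    arith = solve 4 (λ m k n t → m :+ (con 1 :+ k) :+ (t :+ (con 1 :+ k) :* n)
                                := m :+ (con 1 :+ n :+ t :+ k :* (con 1 :+ n))) refl

  eval-triangle : ∀ c a x → eval (triangle act) (around a x c [] []) ≡ around (iterate (tri (length c)) F a) x [] (zeros (length c)) []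
  eval-triangle c a x = trans (eval-from c 0 0 a x)
    (cong₂ (λ i j → around (iterate i F a) x [] (zeros j) []) (+-identityʳ (tri (length c))) (+-identityʳ (length c)))

-- Programs for padding and unpadding

padIn padOut pad : Prog 11
padIn  = for (# 0) (λ b → push (# 1) [ b ])
padOut = for (# 1) (λ b → push (# 0) [ b ] ⨾ push (# 2) [ false ]) ⨾ push (# 0) [ true ] ⨾ triangle (push (# 0) [ false ])
pad    = padIn ⨾ padOut

-- Two parts, because stack 0 drives the loop of `padIn` but receives quadratically many zeros in
-- `padOut`, where it has to be free.
pad-efficient : Efficient pad
pad-efficient = ⨾-efficient {p = padIn} {padOut} (tame-efficient (λ _ → false) padIn tt) (tame-efficient (λ i → i == # 0) padOut tt)

eval-pad : ∀ x v → eval pad (x ∷ [] ∷ [] ∷ [] ∷ [] ∷ v) ≡ padded x ∷ [] ∷ [] ∷ zeros (length x) ∷ [] ∷ v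
eval-pad x v = begin
  eval padOut (eval padIn (around (x , v) [] [] [] []))  ≡⟨ cong (eval padOut) (eval-in x [] []) ⟩
  eval padOut (around ([] , v) (x ʳ++ []) [] [] [])      ≡⟨ cong (λ s → eval (triangle (push (# 0) [ false ])) (eval (push (# 0) [ true ]) s)) (eval-out (x ʳ++ []) [] 0) ⟩
  eval (triangle (push (# 0) [ false ])) (around (true ∷ (x ʳ++ []) ʳ++ [] , v) [] (zeros (length (x ʳ++ []) + 0)) [] [])
    ≡⟨ cong₂ (λ x n → eval (triangle (push (# 0) [ false ])) (around (true ∷ x , v) [] (zeros n) [] []))
         (trans (ʳ++-ʳ++ x) (++-identityʳ x)) (trans (+-identityʳ _) (trans (length-ʳ++ x) (+-identityʳ _))) ⟩
  eval (triangle (push (# 0) [ false ])) (around (true ∷ x , v) [] (zeros (length x)) [] [])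
    ≡⟨ eval-triangle (zeros (length x)) (true ∷ x , v) [] ⟩
  around (iterate (tri (length (zeros (length x)))) prefix (true ∷ x , v)) [] [] (zeros (length (zeros (length x)))) []
    ≡⟨ cong (λ n → around (iterate (tri n) prefix (true ∷ x , v)) [] [] (zeros n) []) (length-replicate (length x)) ⟩
  around (iterate (tri (length x)) prefix (true ∷ x , v)) [] [] (zeros (length x)) []
    ≡⟨ cong (λ a → around a [] [] (zeros (length x)) []) (iterate-prefix (tri (length x)) (true ∷ x)) ⟩
  around (padded x , v) [] [] (zeros (length x)) [] ∎
  where
  open ≡-Reasoning
  prefix : Rest → Rest
  prefix (h , v) = false ∷ h , v
  open Triangle (push (# 0) [ false ]) prefix (λ _ _ _ _ _ → refl)
  eval-in : ∀ x y c → eval padIn (around (x , v) y c [] []) ≡ around ([] , v) (x ʳ++ y) c [] []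
  eval-in []      y c = refl
  eval-in (b ∷ x) y c = eval-in x (b ∷ y) c
  eval-out : ∀ y x n → eval (for (# 1) (λ b → push (# 0) [ b ] ⨾ push (# 2) [ false ])) (around (x , v) y (zeros n) [] [])
                     ≡ around (y ʳ++ x , v) [] (zeros (length y + n)) [] []
  eval-out []      x n = refl
  eval-out (b ∷ y) x n = trans (eval-out y (b ∷ x) (suc n)) (cong (λ m → around (y ʳ++ (b ∷ x) , v) [] (zeros m) [] []) (+-suc (length y) n))
  iterate-prefix : ∀ n h → iterate n prefix (h , v) ≡ (zeros n ++ h , v)
  iterate-prefix zero    h = refl
  iterate-prefix (suc n) h = trans (iterate-prefix n (false ∷ h)) (cong (_, v) (zeros-∷ n h))
    where
    zeros-∷ : ∀ n h → zeros n ++ false ∷ h ≡ zeros (suc n) ++ h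
    zeros-∷ zero    h = refl
    zeros-∷ (suc n) h = cong (false ∷_) (zeros-∷ n h)

pad-computable : PolyTimeComputable padded
pad-computable = computable-≗ (efficient⇒computable pad pad-efficient) λ x → cong Vec.head (eval-pad x (Vec.replicate 7 []))

-- Stack 7 is nonempty once the separating 1 has been seen. Before that, zeros are counted on stack
-- 6; afterwards, letters are collected on stack 1 and counted on stack 2, which makes the latter
-- the input of `triangle`.
split : Bool → Prog 11
split b = pop (# 7) (λ c → push (# 7) [ c ] ⨾ push (# 1) [ b ] ⨾ push (# 2) [ false ])
                    (if b then push (# 7) [ true ] else push (# 6) [ false ])

removeZero : Prog 11
removeZero = pop (# 6) (λ _ → skip) (push (# 5) [ true ])

-- Stack 5 serves as an error flag.
checks parse : Prog 11
checks = pop (# 6) (λ _ → push (# 5) [ true ]) skip ⨾ pop (# 7) (λ c → push (# 7) [ c ]) (push (# 5) [ true ])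
parse  = for (# 0) split ⨾ triangle removeZero ⨾ checks

parse-efficient : Efficient parse
parse-efficient = tame-efficient (λ i → (i == # 1) ∨ (i == # 5)) parse tt

data Split : Word → Set where
  zerosOnly : ∀ n → Split (zeros n)
  separated : ∀ n x → Split (zeros n ++ true ∷ x)

split? : ∀ y → Split y
split? []          = zerosOnly 0
split? (true ∷ y)  = separated 0 y
split? (false ∷ y) with split? y
... | zerosOnly n   = zerosOnly (suc n)
... | separated n x = separated (suc n) x

padded-not-zeros : ∀ n {x} m → zeros n ≢ zeros m ++ true ∷ x
padded-not-zeros zero    zero    ()
padded-not-zeros zero    (suc m) ()
padded-not-zeros (suc n) zero    ()
padded-not-zeros (suc n) (suc m) e = padded-not-zeros n m (∷-injectiveʳ e)

zeros-++-length : ∀ m n {x y} → zeros m ++ true ∷ x ≡ zeros n ++ true ∷ y → m ≡ n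
zeros-++-length zero    zero    e = refl
zeros-++-length (suc m) (suc n) e = cong suc (zeros-++-length m n (∷-injectiveʳ e))
zeros-++-length zero    (suc n) ()
zeros-++-length (suc m) zero    ()

module _ (r : Vec Word 4) where

  eval-split-after : ∀ y x n z → eval (for (# 0) split) (y ∷ x ∷ zeros n ∷ [] ∷ [] ∷ [] ∷ z ∷ [ true ] ∷ r)
    ≡ [] ∷ (y ʳ++ x) ∷ zeros (length y + n) ∷ [] ∷ [] ∷ [] ∷ z ∷ [ true ] ∷ r
  eval-split-after []      x n z = refl
  eval-split-after (b ∷ y) x n z = trans (eval-split-after y (b ∷ x) (suc n) z)
    (cong (λ m → [] ∷ (y ʳ++ (b ∷ x)) ∷ zeros m ∷ [] ∷ [] ∷ [] ∷ z ∷ [ true ] ∷ r) (+-suc (length y) n))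

  eval-split : ∀ n x m → eval (for (# 0) split) ((zeros n ++ true ∷ x) ∷ [] ∷ [] ∷ [] ∷ [] ∷ [] ∷ zeros m ∷ [] ∷ r)
    ≡ [] ∷ reverse x ∷ zeros (length x) ∷ [] ∷ [] ∷ [] ∷ zeros (n + m) ∷ [ true ] ∷ r
  eval-split zero    x m = trans (eval-split-after x [] 0 (zeros m))
    (cong (λ k → [] ∷ reverse x ∷ zeros k ∷ [] ∷ [] ∷ [] ∷ zeros m ∷ [ true ] ∷ r) (+-identityʳ _))
  eval-split (suc n) x m = trans (eval-split n x (suc m))
    (cong (λ k → [] ∷ reverse x ∷ zeros (length x) ∷ [] ∷ [] ∷ [] ∷ zeros k ∷ [ true ] ∷ r) (+-suc n m))

  eval-split-zeros : ∀ n m → eval (for (# 0) split) (zeros n ∷ [] ∷ [] ∷ [] ∷ [] ∷ [] ∷ zeros m ∷ [] ∷ r)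
    ≡ [] ∷ [] ∷ [] ∷ [] ∷ [] ∷ [] ∷ zeros (n + m) ∷ [] ∷ r
  eval-split-zeros zero    m = refl
  eval-split-zeros (suc n) m = trans (eval-split-zeros n (suc m))
    (cong (λ k → [] ∷ [] ∷ [] ∷ [] ∷ [] ∷ [] ∷ zeros k ∷ [] ∷ r) (+-suc n m))

  remove : Rest → Rest
  remove (h , e ∷ []      ∷ v) = h , (true ∷ e) ∷ [] ∷ v
  remove (h , e ∷ (_ ∷ z) ∷ v) = h , e ∷ z ∷ v

  eval-remove : ∀ a x c t u → eval removeZero (around a x c t u) ≡ around (remove a) x c t u
  eval-remove (h , e ∷ []      ∷ v) x c t u = refl
  eval-remove (h , e ∷ (_ ∷ z) ∷ v) x c t u = refl

  open Triangle removeZero remove eval-remove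

  remove-exact : ∀ n v → iterate n remove ([] , [] ∷ zeros n ∷ v) ≡ ([] , [] ∷ [] ∷ v)
  remove-exact zero    v = refl
  remove-exact (suc n) v = remove-exact n v

  -- The disjunction is an invariant. A mismatch between zeros and pending removals survives a
  -- removal; it raises the flag when the zeros run out too early, and otherwise leaves zeros over.
  remove-error : ∀ m n e v → n ≢ m ⊎ e ≢ [] →
    ∃[ e′ ] ∃[ z ] iterate m remove ([] , e ∷ zeros n ∷ v) ≡ ([] , e′ ∷ z ∷ v) × (e′ ≢ [] ⊎ z ≢ [])
  remove-error zero    zero    e v (inj₁ n≢m) = ⊥-elim (n≢m refl)
  remove-error zero    (suc n) e v (inj₁ n≢m) = e , _ , refl , inj₂ (λ ())
  remove-error zero    n       e v (inj₂ e≢)  = e , _ , refl , inj₁ e≢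
  remove-error (suc m) zero    e v _          = remove-error m zero (true ∷ e) v (inj₂ (λ ()))
  remove-error (suc m) (suc n) e v (inj₁ n≢m) = remove-error m n e v (inj₁ (n≢m ∘ cong suc))
  remove-error (suc m) (suc n) e v (inj₂ e≢)  = remove-error m n e v (inj₂ e≢)

  -- For an invalid word only the empty stack 0 and the raised flag are recorded, as the programs
  -- that follow then give a fixed answer on stack 0.
  data Parsed (y : Word) : Stacks 11 → Set where
    valid   : ∀ x → y ≡ padded x → Parsed y ([] ∷ reverse x ∷ [] ∷ zeros (length x) ∷ [] ∷ [] ∷ [] ∷ [ true ] ∷ r)
    invalid : (∀ x → y ≢ padded x) → ∀ {x₁ x₂ x₃ x₄ b e v} → Parsed y ([] ∷ x₁ ∷ x₂ ∷ x₃ ∷ x₄ ∷ (b ∷ e) ∷ v)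

  checks-error : ∀ {y x₁ x₂ x₃ x₄ m} → (∀ x → y ≢ padded x) → ∀ e z → e ≢ [] ⊎ z ≢ [] →
    Parsed y (eval checks ([] ∷ x₁ ∷ x₂ ∷ x₃ ∷ x₄ ∷ e ∷ z ∷ m ∷ r))
  checks-error {m = []}    bad []      []      (inj₁ e≢) = invalid bad
  checks-error {m = []}    bad []      []      (inj₂ z≢) = ⊥-elim (z≢ refl)
  checks-error {m = []}    bad (b ∷ e) []      _         = invalid bad
  checks-error {m = []}    bad e       (b ∷ z) _         = invalid bad
  checks-error {m = _ ∷ _} bad []      []      (inj₁ e≢) = ⊥-elim (e≢ refl)
  checks-error {m = _ ∷ _} bad []      []      (inj₂ z≢) = ⊥-elim (z≢ refl)
  checks-error {m = _ ∷ _} bad (b ∷ e) []      _         = invalid bad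
  checks-error {m = _ ∷ _} bad e       (b ∷ z) _         = invalid bad

  parsed : ∀ y → Parsed y (eval parse (y ∷ [] ∷ [] ∷ [] ∷ [] ∷ [] ∷ [] ∷ [] ∷ r))
  parsed y with split? y
  ... | zerosOnly n = subst (Parsed (zeros n)) (sym (cong (eval (triangle removeZero ⨾ checks)) (eval-split-zeros n 0)))
      (last (zeros (n + 0)))
    where
    last : ∀ z → Parsed (zeros n) (eval checks ([] ∷ [] ∷ [] ∷ [] ∷ [] ∷ [] ∷ z ∷ [] ∷ r))
    last []      = invalid (λ x → padded-not-zeros n (tri (length x)))
    last (b ∷ z) = invalid (λ x → padded-not-zeros n (tri (length x)))
  ... | separated n x = subst (Parsed (zeros n ++ true ∷ x)) (sym eq) last
    where
    eq : eval parse ((zeros n ++ true ∷ x) ∷ [] ∷ [] ∷ [] ∷ [] ∷ [] ∷ [] ∷ [] ∷ r)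
       ≡ eval checks (around (iterate (tri (length x)) remove ([] , [] ∷ zeros n ∷ [ true ] ∷ r)) (reverse x) [] (zeros (length x)) [])
    eq = cong (eval checks) (trans (cong (eval (triangle removeZero)) (eval-split n x 0))
      (trans (eval-triangle (zeros (length x)) ([] , [] ∷ zeros (n + 0) ∷ [ true ] ∷ r) (reverse x))
        (cong₂ (λ k m → around (iterate (tri k) remove ([] , [] ∷ zeros m ∷ [ true ] ∷ r)) (reverse x) [] (zeros k) [])
          (length-replicate (length x)) (+-identityʳ n))))
    last : Parsed (zeros n ++ true ∷ x) (eval checks
      (around (iterate (tri (length x)) remove ([] , [] ∷ zeros n ∷ [ true ] ∷ r)) (reverse x) [] (zeros (length x)) []))
    last with n ≟ tri (length x)
    ... | yes refl rewrite remove-exact (tri (length x)) ([ true ] ∷ r) = valid x refl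
    ... | no n≢ with remove-error (tri (length x)) n [] ([ true ] ∷ r) (inj₁ n≢)
    ...   | e′ , z , eq′ , ne rewrite eq′ = checks-error bad e′ z ne
      where
      bad : ∀ x′ → zeros n ++ true ∷ x ≢ padded x′
      bad x′ e = n≢ (trans (zeros-++-length n (tri (length x′)) e)
        (cong (tri ∘ length) (sym (++-true-injective n (tri (length x′)) e))))

answer unpad : Word → Prog 11
answer a = pop (# 5) (λ _ → push (# 0) (reverse a)) (for (# 1) (λ b → push (# 0) [ b ]))
unpad a  = parse ⨾ answer a

unpad-efficient : ∀ a → Efficient (unpad a)
unpad-efficient a = ⨾-efficient {p = parse} {answer a} parse-efficient (tame-efficient (λ i → i == # 0) (answer a) tt)

-- The backward reduction removes the padding and sends every word that is not padded to the fixed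
-- nonmember `a`.
padding : ∀ (A : Language) → (∃[ x ] x ∉ A) → A ≡ᵖₘ (λ y → ∃[ x ] x ∈ A × y ≡ padded x)
padding A (a , a∉) =
  (padded , pad-computable , λ x → mk⇔ (λ x∈ → x , x∈ , refl) λ { (x′ , x′∈ , e) → subst A (sym (padded-injective e)) x′∈ })
  , (g , efficient⇒computable (unpad a) (unpad-efficient a) , λ y → mk⇔ (to y) (from y))
  where
  g : Word → Word
  g y = Vec.head (eval (unpad a) (y ∷ Vec.replicate 11 []))
  unpadded : ∀ y → (∃[ x ] y ≡ padded x × g y ≡ x) ⊎ ((∀ x → y ≢ padded x) × g y ≡ a)
  unpadded y with eval parse (y ∷ Vec.replicate 11 []) | parsed (Vec.replicate 4 []) y
  ... | _ | valid x e = inj₁ (x , e , trans (copy (reverse x) []) (trans (ʳ++-defn (reverse x)) (trans (++-identityʳ _) (reverse-involutive x))))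
    where
    copy : ∀ x h {v : Vec Word 10} → Vec.head (eval (for (# 1) (λ b → push (# 0) [ b ])) (h ∷ x ∷ v)) ≡ x ʳ++ h
    copy []      h = refl
    copy (b ∷ x) h = copy x (b ∷ h)
  ... | _ | invalid bad = inj₂ (bad , trans (ʳ++-defn (reverse a)) (trans (++-identityʳ _) (reverse-involutive a)))
  to : ∀ y → (∃[ x ] x ∈ A × y ≡ padded x) → g y ∈ A
  to y (x , x∈ , e) with unpadded y
  ... | inj₁ (x′ , e′ , eq) = subst A (sym (trans eq (padded-injective (trans (sym e′) e)))) x∈
  ... | inj₂ (bad , _)      = ⊥-elim (bad x e)
  from : ∀ y → g y ∈ A → ∃[ x ] x ∈ A × y ≡ padded x
  from y gy∈ with unpadded y
  ... | inj₁ (x , e , eq) = x , subst A eq gy∈ , e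
  ... | inj₂ (_ , eq)     = ⊥-elim (a∉ (subst A eq gy∈))

padded-¬paddable : ∀ {A : Language} → ∃[ x ] x ∈ A → ¬ TightPaddable (λ y → ∃[ x ] x ∈ A × y ≡ padded x)
padded-¬paddable (x , x∈) = gaps⇒¬paddable (λ { (x , _ , refl) → length x , length-padded x }) (padded x , x , x∈ , refl)

-- A universal verifier

-- Needed because a token takes several letters off the stack that drives the loop over the tokens:
-- the fuel left after it exceeds the height of that stack, while `eval tokens` starts with fuel
-- equal to the height.
loop-fuel : ∀ {n} i f → (∀ b s → length (lookup (f b s) i) ≤ length (lookup s i)) →
  ∀ m m′ (s : Stacks n) → length (lookup s i) ≤ m → length (lookup s i) ≤ m′ → loop m i f s ≡ loop m′ i f s
loop-fuel i f h zero    zero     s le le′ = refl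
loop-fuel i f h zero    (suc m′) s le le′ with lookup s i
... | [] = refl
loop-fuel i f h (suc m) zero     s le le′ with lookup s i
... | [] = refl
loop-fuel i f h (suc m) (suc m′) s le le′ with lookup s i
... | []    = refl
... | b ∷ w = loop-fuel i f h m m′ (f b (s [ i ]≔ w)) (shorter le) (shorter le′)
  where
  shorter : ∀ {k} → suc (length w) ≤ suc k → length (lookup (f b (s [ i ]≔ w)) i) ≤ k
  shorter (s≤s le) = ≤-trans (h b _) (≤-trans (≤-reflexive (cong length (lookup∘updateAt i s))) le)

decodeMove : Bool → Bool → Move
decodeMove false false = moveL
decodeMove false true  = moveR
decodeMove true  _     = stay

encodeMove : Move → Word
encodeMove moveL = false ∷ false ∷ []
encodeMove moveR = false ∷ true ∷ []
encodeMove stay  = true ∷ true ∷ []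

-- One step on a tape of bits: the bit expected at the head, the bit to write, and the move.
Turn : Set
Turn = Bool × Bool × Move

-- Token codes: 01b puts b in front of the tape, 1bb′m is an optional turn, and 00 ends a tape.
loadCode : Bool → Word
loadCode b = false ∷ true ∷ b ∷ []

turnCode : Turn → Word
turnCode (b , b′ , m) = true ∷ b ∷ b′ ∷ encodeMove m

endCode : Word
endCode = false ∷ false ∷ []

-- Stacks: 0 errors, 1 tokens, 8 and 9 the guessed word (unread and read), 10 and 11 the tape of
-- bits (to the left of the head, and from the head on, implicitly continued by zeros).
expect : Bool → Bool → Prog 11
expect true  true  = skip
expect false false = skip
expect _     _     = push (# 0) [ true ]

advance : Bool → Move → Prog 11
advance b′ stay  = push (# 11) [ b′ ]
advance b′ moveR = push (# 10) [ b′ ]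
advance b′ moveL = push (# 11) [ b′ ] ⨾ pop (# 10) (λ c → push (# 11) [ c ]) (push (# 11) [ false ])

perform : Turn → Prog 11
perform (b , b′ , m) = pop (# 11) (expect b) (expect b false) ⨾ advance b′ m

-- The bit read is saved on stack 9, from which `endTape` restores the certificate, since every
-- track has to replay the same selection. With the certificate exhausted the turn is skipped, as in
-- `select`.
option : Turn → Prog 11
option t = pop (# 8) (λ c → push (# 9) [ c ] ⨾ (if c then perform t else skip)) skip

-- A computation has to end with no state and with blanks under all heads, so on every track the
-- last bit at the head must be 0. Emptying both halves of the tape prepares the next track.
endTape : Prog 11
endTape = pop (# 11) (expect false) skip ⨾ for (# 11) (λ _ → skip) ⨾ for (# 10) (λ _ → skip) ⨾ for (# 9) (λ c → push (# 8) [ c ])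

token : Bool → Prog 11
token true  = pop (# 1) (λ b → pop (# 1) (λ b′ → pop (# 1) (λ m → pop (# 1) (λ m′ →
                option (b , b′ , decodeMove m m′)) skip) skip) skip) skip
token false = pop (# 1) (λ c → if c then pop (# 1) (λ b → push (# 11) [ b ]) skip else endTape) skip

-- Anything left on stack 0 means rejection. The loop over stack 2 undoes the reversal caused by
-- reading the input. As `parse` leaves its result reversed on stack 1, an instance is the padded
-- form of a reversed code.
tokens verify : Prog 11
tokens = for (# 1) token
verify = for (# 2) (λ b → push (# 0) [ b ]) ⨾ parse ⨾ pop (# 5) (λ _ → push (# 0) [ true ]) tokens

-- The loop over the tokens is tame with no free stack at all, because the letters of a token pay
-- for whatever its execution pushes. It is separated from `parse`, in which stack 1 is free.
verify-efficient : Efficient verify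
verify-efficient = ⨾-efficient {p = input′} {parse ⨾ run} (tame-efficient (λ _ → false) input′ tt)
  (⨾-efficient {p = parse} {run} parse-efficient (tame-efficient (λ _ → false) run tt))
  where
  input′ run : Prog 11
  input′ = for (# 2) (λ b → push (# 0) [ b ])
  run = pop (# 5) (λ _ → push (# 0) [ true ]) tokens

hd : Word → Bool
hd []      = false
hd (b ∷ _) = b

tl : Word → Word
tl []      = []
tl (_ ∷ w) = w

turn : Bool → Move → Word × Word → Word × Word
turn b stay  (l , r) = l , b ∷ tl r
turn b moveR (l , r) = b ∷ l , tl r
turn b moveL (l , r) = tl l , hd l ∷ b ∷ tl r

Succeeds : List Turn → Word × Word → Set
Succeeds []                  (l , r) = hd r ≡ false
Succeeds ((b , b′ , m) ∷ ts) (l , r) = hd r ≡ b × Succeeds ts (turn b′ m (l , r))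

select : ∀ {A : Set} → Word → List A → List A
select []          as       = []
select (b ∷ w)     []       = []
select (true ∷ w)  (a ∷ as) = a ∷ select w as
select (false ∷ w) (a ∷ as) = select w as

select-map : ∀ {A B : Set} (f : A → B) w as → select w (List.map f as) ≡ List.map f (select w as)
select-map f []          as       = refl
select-map f (b ∷ w)     []       = refl
select-map f (true ∷ w)  (a ∷ as) = cong (f a ∷_) (select-map f w as)
select-map f (false ∷ w) (a ∷ as) = select-map f w as

-- The bits initially on the tape (nearest to the end first) and the turns.
Section : Set
Section = Word × List Turn

sectionCode : Section → Word
sectionCode (ls , ts) = List.concatMap loadCode ls ++ List.concatMap turnCode ts ++ endCode

SectionSucceeds : Word → Section → Set
SectionSucceeds w (ls , ts) = Succeeds (select w ts) ([] , ls ʳ++ [])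

-- Correctness of the verifier

module _ (k : ℕ) where

  -- The zeros on stack 3 and the mark on stack 7 are left behind by `parse`; the tokens do not
  -- touch them.
  state : Word → Word → Word → Word → Word × Word → Stacks 11
  state e x w w′ (l , r) = e ∷ x ∷ [] ∷ zeros k ∷ [] ∷ [] ∷ [] ∷ [ true ] ∷ w ∷ w′ ∷ l ∷ r ∷ []

  mark : Bool → Bool → Word → Word
  mark true  true  e = e
  mark false false e = e
  mark _     _     e = true ∷ e

  eval-tokens : ∀ m s → length (lookup s (# 1)) ≤ m → loop m (# 1) (λ b → eval (token b)) s ≡ eval tokens s
  eval-tokens m s le = loop-fuel (# 1) (λ b → eval (token b)) (both _ (eval-keeps (# 1) (token false) tt) (eval-keeps (# 1) (token true) tt))
    m _ s le ≤-refl

  eval-load : ∀ b e x w w′ l r → eval tokens (state e (loadCode b ++ x) w w′ (l , r)) ≡ eval tokens (state e x w w′ (l , b ∷ r))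
  eval-load b e x w w′ l r = eval-tokens _ (state e x w w′ (l , b ∷ r)) (m≤n+m (length x) 2)

  eval-expect : ∀ b c e x w w′ h → eval (expect b c) (state e x w w′ h) ≡ state (mark b c e) x w w′ h
  eval-expect true  true  e x w w′ h = refl
  eval-expect false false e x w w′ h = refl
  eval-expect true  false e x w w′ h = refl
  eval-expect false true  e x w w′ h = refl

  eval-advance : ∀ b m e x w w′ l r → eval (advance b m) (state e x w w′ (l , tl r)) ≡ state e x w w′ (turn b m (l , r))
  eval-advance b stay  e x w w′ l       r = refl
  eval-advance b moveR e x w w′ l       r = refl
  eval-advance b moveL e x w w′ []      r = refl
  eval-advance b moveL e x w w′ (c ∷ l) r = refl

  eval-perform : ∀ b b′ m e x w w′ l r →
    eval (perform (b , b′ , m)) (state e x w w′ (l , r)) ≡ state (mark b (hd r) e) x w w′ (turn b′ m (l , r))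
  eval-perform b b′ m e x w w′ l []      = trans (cong (eval (advance b′ m)) (eval-expect b false e x w w′ (l , []))) (eval-advance b′ m _ x w w′ l [])
  eval-perform b b′ m e x w w′ l (c ∷ r) = trans (cong (eval (advance b′ m)) (eval-expect b c e x w w′ (l , r))) (eval-advance b′ m _ x w w′ l (c ∷ r))

  keeps-option : ∀ b b′ m → T (keeps (# 1) (option (b , b′ , m)))
  keeps-option false b′ moveL = tt
  keeps-option false b′ moveR = tt
  keeps-option false b′ stay  = tt
  keeps-option true  b′ moveL = tt
  keeps-option true  b′ moveR = tt
  keeps-option true  b′ stay  = tt

  eval-turn : ∀ t e x w w′ h → eval tokens (state e (turnCode t ++ x) w w′ h) ≡ eval tokens (eval (option t) (state e x w w′ h))
  eval-turn (b , b′ , m) e x w w′ h = trans (cong (λ s → loop (2 + length (encodeMove m ++ x)) (# 1) (λ b → eval (token b)) s) (decoded m))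
    (eval-tokens _ (eval (option (b , b′ , m)) (state e x w w′ h))
      (≤-trans (eval-keeps (# 1) (option (b , b′ , m)) (keeps-option b b′ m) (state e x w w′ h))
        (≤-trans (m≤n+m (length x) (2 + length (encodeMove m))) (≤-reflexive (cong (2 +_) (sym (length-++ (encodeMove m))))))))
    where
    E : Stacks 11
    E = state e x w w′ h
    decoded : ∀ m → eval (token true) (state e (b ∷ b′ ∷ encodeMove m ++ x) w w′ h) ≡ eval (option (b , b′ , m)) E
    decoded moveL = refl
    decoded moveR = refl
    decoded stay  = refl

  eval-clear : ∀ e x w w′ l r → eval (for (# 11) (λ _ → skip) ⨾ for (# 10) (λ _ → skip) ⨾ for (# 9) (λ c → push (# 8) [ c ])) (state e x w w′ (l , r))
    ≡ state e x (w′ ʳ++ w) [] ([] , [])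
  eval-clear e x w w′ l       (b ∷ r) = eval-clear e x w w′ l r
  eval-clear e x w w′ (b ∷ l) []      = eval-clear e x w w′ l []
  eval-clear e x w (b ∷ w′) [] []     = eval-clear e x (b ∷ w) w′ [] []
  eval-clear e x w []       [] []     = refl

  eval-end : ∀ e x w w′ l r → eval tokens (state e (endCode ++ x) w w′ (l , r)) ≡ eval tokens (state (mark false (hd r) e) x (w′ ʳ++ w) [] ([] , []))
  eval-end e x w w′ l r = trans (cong (loop (1 + length x) (# 1) (λ b → eval (token b))) (ended r)) (eval-tokens _ (state (mark false (hd r) e) x (w′ ʳ++ w) [] ([] , [])) (m≤n+m (length x) 1))
    where
    ended : ∀ r → eval endTape (state e x w w′ (l , r)) ≡ state (mark false (hd r) e) x (w′ ʳ++ w) [] ([] , [])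
    ended []          = eval-clear e x w w′ l []
    ended (false ∷ r) = eval-clear e x w w′ l r
    ended (true ∷ r)  = eval-clear (true ∷ e) x w w′ l r

  eval-loads : ∀ ls e x w w′ l r →
    eval tokens (state e (List.concatMap loadCode ls ++ x) w w′ (l , r)) ≡ eval tokens (state e x w w′ (l , ls ʳ++ r))
  eval-loads []       e x w w′ l r = refl
  eval-loads (b ∷ ls) e x w w′ l r = trans (eval-load b e (List.concatMap loadCode ls ++ x) w w′ l r) (eval-loads ls e x w w′ l (b ∷ r))

  mark-[] : ∀ b c e → mark b c e ≡ [] ⇔ (e ≡ [] × c ≡ b)
  mark-[] true  true  e = mk⇔ (_, refl) proj₁
  mark-[] false false e = mk⇔ (_, refl) proj₁
  mark-[] true  false e = mk⇔ (λ ()) (λ { (_ , ()) })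
  mark-[] false true  e = mk⇔ (λ ()) (λ { (_ , ()) })

  eval-first : ∀ t ts e y w w′ h → eval tokens (state e (List.concatMap turnCode (t ∷ ts) ++ y) w w′ h)
    ≡ eval tokens (eval (option t) (state e (List.concatMap turnCode ts ++ y) w w′ h))
  eval-first t ts e y w w′ h = trans (cong (λ x → eval tokens (state e x w w′ h)) (++-assoc (turnCode t) (List.concatMap turnCode ts) y))
    (eval-turn t e (List.concatMap turnCode ts ++ y) w w′ h)

  -- The word `w′ ʳ++ w` is the whole certificate throughout, so the next section finds it restored.
  -- The error stack is described only as far as its emptiness goes.
  eval-turns : ∀ ts e x w w′ l r → ∃[ e′ ]
    eval tokens (state e (List.concatMap turnCode ts ++ endCode ++ x) w w′ (l , r)) ≡ eval tokens (state e′ x (w′ ʳ++ w) [] ([] , []))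
    × (e′ ≡ [] ⇔ (e ≡ [] × Succeeds (select w ts) (l , r)))
  eval-turns [] e x w w′ l r = mark false (hd r) e , eval-end e x w w′ l r , lemma w
    where
    lemma : ∀ w → mark false (hd r) e ≡ [] ⇔ (e ≡ [] × Succeeds (select w []) (l , r))
    lemma []      = mark-[] false (hd r) e
    lemma (_ ∷ _) = mark-[] false (hd r) e
  eval-turns (t ∷ ts) e x [] w′ l r with eval-turns ts e x [] w′ l r
  ... | e′ , eq , iff = e′ , trans (eval-first t ts e (endCode ++ x) [] w′ (l , r)) eq , iff
  eval-turns (t ∷ ts) e x (false ∷ w) w′ l r with eval-turns ts e x w (false ∷ w′) l r
  ... | e′ , eq , iff = e′ , trans (eval-first t ts e (endCode ++ x) (false ∷ w) w′ (l , r)) eq , iff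
  eval-turns (t@(b , b′ , m) ∷ ts) e x (true ∷ w) w′ l r
    with eval-turns ts (mark b (hd r) e) x w (true ∷ w′) (proj₁ (turn b′ m (l , r))) (proj₂ (turn b′ m (l , r)))
  ... | e′ , eq , iff = e′ , trans (eval-first t ts e (endCode ++ x) (true ∷ w) w′ (l , r)) (trans (cong (eval tokens) (eval-perform b b′ m e _ w (true ∷ w′) l r)) eq) ,
    mk⇔ (λ e′≡ → let me , s = Equivalence.to iff e′≡ ; e≡ , h = Equivalence.to (mark-[] b (hd r) e) me in e≡ , h , s)
        (λ { (e≡ , h , s) → Equivalence.from iff (Equivalence.from (mark-[] b (hd r) e) (e≡ , h) , s) })

  eval-sections : ∀ ss e w → Vec.head (eval tokens (state e (List.concatMap sectionCode ss) w [] ([] , []))) ≡ []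
    ⇔ (e ≡ [] × All (SectionSucceeds w) ss)
  eval-sections [] e w = mk⇔ (_, []) proj₁
  eval-sections ((ls , ts) ∷ ss) e w with eval-turns ts e (List.concatMap sectionCode ss) w [] [] (ls ʳ++ [])
  ... | e′ , eq , iff = mk⇔
      (λ h → let e′≡ , a = Equivalence.to (eval-sections ss e′ w) (trans (cong Vec.head (sym whole)) h)
                 e≡ , s = Equivalence.to iff e′≡ in e≡ , s ∷ a)
      (λ { (e≡ , s ∷ a) → trans (cong Vec.head whole) (Equivalence.from (eval-sections ss e′ w) (Equivalence.from iff (e≡ , s) , a)) })
    where
    x = List.concatMap sectionCode ss
    whole : eval tokens (state e (sectionCode (ls , ts) ++ x) w [] ([] , [])) ≡ eval tokens (state e′ x w [] ([] , []))
    whole = trans (cong (λ y → eval tokens (state e y w [] ([] , [])))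
        (trans (++-assoc (List.concatMap loadCode ls) _ x) (cong (List.concatMap loadCode ls ++_) (++-assoc (List.concatMap turnCode ts) endCode x))))
      (trans (eval-loads ls e _ w [] [] []) eq)

-- Since `verify` rejects every word that is not padded, the gap argument applies to this set
-- itself.
Universal : Language
Universal y = ∃[ w ] length w ≡ length y × AcceptsGuess verify (reverse y) w

module _ (y w : Word) where

  private
    guarded : Prog 11
    guarded = pop (# 5) (λ _ → push (# 0) [ true ]) tokens
    r : Vec Word 4
    r = w ∷ [] ∷ [] ∷ [] ∷ []

  unreversed : ∀ v u → eval (for (# 2) (λ b → push (# 0) [ b ])) (u ∷ [] ∷ v ∷ [] ∷ [] ∷ [] ∷ [] ∷ [] ∷ r)
                     ≡ (v ʳ++ u) ∷ [] ∷ [] ∷ [] ∷ [] ∷ [] ∷ [] ∷ [] ∷ r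
  unreversed []      u = refl
  unreversed (b ∷ v) u = unreversed v (b ∷ u)

  eval-verify : eval verify (guessed (reverse y) w) ≡ eval guarded (eval parse (y ∷ [] ∷ [] ∷ [] ∷ [] ∷ [] ∷ [] ∷ [] ∷ r))
  eval-verify = cong (λ s → eval guarded (eval parse s)) (trans (unreversed (reverse y) [])
    (cong (λ y → y ∷ [] ∷ [] ∷ [] ∷ [] ∷ [] ∷ [] ∷ [] ∷ r) (trans (ʳ++-defn (reverse y)) (trans (++-identityʳ _) (reverse-involutive y)))))

  verify-spec : AcceptsGuess verify (reverse y) w ⇔
    (∃[ x ] y ≡ padded x × Vec.head (eval tokens (state (length x) [] (reverse x) w [] ([] , []))) ≡ [])
  verify-spec = mk⇔ (λ a → to (parsed r y) (trans (cong Vec.head (sym eval-verify)) a))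
                    (λ a → trans (cong Vec.head eval-verify) (from (parsed r y) a))
    where
    Goal : Set
    Goal = ∃[ x ] y ≡ padded x × Vec.head (eval tokens (state (length x) [] (reverse x) w [] ([] , []))) ≡ []
    to : ∀ {s} → Parsed r y s → Vec.head (eval guarded s) ≡ [] → Goal
    to (valid x e)   h = x , e , h
    from : ∀ {s} → Parsed r y s → Goal → Vec.head (eval guarded s) ≡ []
    from (valid x e)   (x′ , e′ , h) with refl ← padded-injective {x} {x′} (trans (sym e) e′) = h
    from (invalid bad) (x′ , e′ , h) = ⊥-elim (bad x′ e′)

Universal-inNP : InNP Universal
Universal-inNP = guess⇒NP {verify} verify-efficient

sections-universal : ∀ ss w → let y = padded (reverse (List.concatMap sectionCode ss)) in
  AcceptsGuess verify (reverse y) w ⇔ All (SectionSucceeds w) ss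
sections-universal ss w = mk⇔
  (λ a → let x , e , h = Equivalence.to (verify-spec (padded (reverse code)) w) a in
    proj₂ (Equivalence.to (eval-sections (length x) ss [] w)
      (trans (cong (λ z → Vec.head (eval tokens (state (length x) [] z w [] ([] , []))))
        (trans (sym (reverse-involutive code)) (cong reverse (padded-injective {reverse code} {x} e)))) h)))
  (λ s → Equivalence.from (verify-spec (padded (reverse code)) w) (reverse code , refl ,
    trans (cong (λ z → Vec.head (eval tokens (state (length (reverse code)) [] z w [] ([] , [])))) (reverse-involutive code))
      (Equivalence.from (eval-sections (length (reverse code)) ss [] w) (refl , s))))
  where
  code : Word
  code = List.concatMap sectionCode ss

Universal-¬paddable : ¬ TightPaddable Universal
Universal-¬paddable = gaps⇒¬paddable
  (λ { {y} (w , _ , a) → let x , e , _ = Equivalence.to (verify-spec y w) a in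
         length x , trans (cong length e) (length-padded x) })
  -- The code with no sections accepts every certificate; `padded []` consists of the separator
  -- alone, so the certificate has one bit.
  (padded [] , [ true ] , refl , Equivalence.from (sections-universal [] [ true ]) [])

-- Encoding a machine by sections of turns

-- With `nothing` for the blank and for the state after acceptance, these are 0 on every track. This
-- agrees with tapes of bits being continued by zeros and with the test for 0 at the end of a track.
has : ∀ {A : Set} → DecidableEquality A → A → Maybe A → Bool
has _≟ᴬ_ a nothing  = false
has _≟ᴬ_ a (just b) = does (a ≟ᴬ b)

has-injective : ∀ {A : Set} (_≟ᴬ_ : DecidableEquality A) m m′ → (∀ a → has _≟ᴬ_ a m ≡ has _≟ᴬ_ a m′) → m ≡ m′
has-injective _≟ᴬ_ nothing  nothing  h = refl
has-injective _≟ᴬ_ (just a) m′       h with a ≟ᴬ a | h a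
... | no a≢a | _ = ⊥-elim (a≢a refl)
has-injective _≟ᴬ_ (just a) (just b) h | yes _ | e with a ≟ᴬ b
...   | yes refl = refl
has-injective _≟ᴬ_ nothing  (just b) h with b ≟ᴬ b | h b
... | no b≢b | _ = ⊥-elim (b≢b refl)

vectors : ∀ {A : Set} → List A → ∀ n → List (Vec A n)
vectors as zero    = [ [] ]
vectors as (suc n) = List.cartesianProductWith _∷_ as (vectors as n)

∈-vectors : ∀ {A : Set} {as : List A} → (∀ a → a ∈ˡ as) → ∀ {n} (v : Vec A n) → v ∈ˡ vectors as n
∈-vectors all []      = here refl
∈-vectors all (a ∷ v) = ∈-cartesianProductWith⁺ _∷_ (all a) (∈-vectors all v)

copies : ∀ {A : Set} → ℕ → List A → List A
copies zero    as = []
copies (suc n) as = as ++ copies n as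

select-zeros : ∀ {A : Set} n (as : List A) → select (zeros n) as ≡ []
select-zeros zero    as       = refl
select-zeros (suc n) []       = refl
select-zeros (suc n) (a ∷ as) = select-zeros n as

select-++-zeros : ∀ {A : Set} w n (as : List A) → select (w ++ zeros n) as ≡ select w as
select-++-zeros []          n as       = select-zeros n as
select-++-zeros (b ∷ w)     n []       = refl
select-++-zeros (true ∷ w)  n (a ∷ as) = cong (a ∷_) (select-++-zeros w n as)
select-++-zeros (false ∷ w) n (a ∷ as) = select-++-zeros w n as

select-none : ∀ {A : Set} (bs : List A) w as → select (zeros (length bs) ++ w) (bs ++ as) ≡ select w as
select-none []       w as = refl
select-none (b ∷ bs) w as = select-none bs w as

select-one : ∀ {A : Set} {b : A} {bs} → b ∈ˡ bs →
  ∃[ v ] length v ≡ length bs × (∀ w as → select (v ++ w) (bs ++ as) ≡ b ∷ select w as)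
select-one {bs = b ∷ bs} (here refl) = true ∷ zeros (length bs) , cong suc (length-replicate _) , λ w as → cong (b ∷_) (select-none bs w as)
select-one {bs = _ ∷ bs} (there b∈) with select-one b∈
... | v , l , eq = false ∷ v , cong suc l , eq

-- A selection cannot reorder or repeat entries, so each entry of the sequence is taken from a copy
-- of its own; the surplus copies contribute nothing.
select-copies : ∀ {A : Set} (bs : List A) n as → All (_∈ˡ bs) as → length as ≤ n →
  ∃[ v ] length v ≡ length (copies n bs) × select v (copies n bs) ≡ as
select-copies bs n       []       _          _        = zeros (length (copies n bs)) , length-replicate _ , select-zeros (length (copies n bs)) (copies n bs)
select-copies bs (suc n) (a ∷ as) (a∈ ∷ as∈) (s≤s le) with select-one a∈ | select-copies bs n as as∈ le
... | v , l , eq | v′ , l′ , eq′ = v ++ v′ , trans (length-++ v) (trans (cong₂ _+_ l l′) (sym (length-++ bs))) ,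
    trans (eq v′ (copies n bs)) (cong (a ∷_) eq′)

All-select : ∀ {A : Set} {P : A → Set} w {as} → All P as → All P (select w as)
All-select []          ps       = []
All-select (b ∷ w)     []       = []
All-select (true ∷ w)  (p ∷ ps) = p ∷ All-select w ps
All-select (false ∷ w) (p ∷ ps) = All-select w ps

All-copies : ∀ {A : Set} {P : A → Set} n {as} → All P as → All P (copies n as)
All-copies zero    ps = []
All-copies (suc n) ps = All.++⁺ ps (All-copies n ps)

-- Each turn takes up at least one letter of the code. Hence a certificate with one bit per turn is
-- no longer than the instance.
sectionCode-length : ∀ {s ss} → s ∈ˡ ss → length (proj₂ s) ≤ length (List.concatMap sectionCode ss)
sectionCode-length {ls , ts} {_ ∷ ss} (here refl) = begin
  length ts                                                ≤⟨ turns ts ⟩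
  length (List.concatMap turnCode ts)                      ≤⟨ m≤m+n _ _ ⟩
  length (List.concatMap turnCode ts) + 2                  ≡⟨ sym (length-++ (List.concatMap turnCode ts)) ⟩
  length (List.concatMap turnCode ts ++ endCode)           ≤⟨ m≤n+m _ _ ⟩
  length (List.concatMap loadCode ls) + length (List.concatMap turnCode ts ++ endCode) ≡⟨ sym (length-++ (List.concatMap loadCode ls)) ⟩
  length (sectionCode (ls , ts))                           ≤⟨ m≤m+n _ _ ⟩
  length (sectionCode (ls , ts)) + length (List.concatMap sectionCode ss) ≡⟨ sym (length-++ (sectionCode (ls , ts))) ⟩
  length (sectionCode (ls , ts) ++ List.concatMap sectionCode ss) ∎
  where
  open ≤-Reasoning
  turns : ∀ ts → length ts ≤ length (List.concatMap turnCode ts)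
  turns []       = z≤n
  turns (t ∷ ts) = s≤s (≤-trans (turns ts) (≤-trans (m≤n+m _ (2 + length (encodeMove (proj₂ (proj₂ t)))))
    (≤-reflexive (cong (2 +_) (sym (length-++ (encodeMove (proj₂ (proj₂ t)))))))))
sectionCode-length {s} {s′ ∷ ss} (there s∈) = ≤-trans (sectionCode-length s∈)
  (≤-trans (m≤n+m _ (length (sectionCode s′))) (≤-reflexive (sym (length-++ (sectionCode s′)))))

module Encoding (N : Machine) where
  open Machine N

  Letter : Set
  Letter = Bool ⊎ Fin aux

  letter : Symbol aux → Maybe Letter
  letter blank     = nothing
  letter (bit b)   = just (inj₁ b)
  letter (extra i) = just (inj₂ i)

  letter-injective : ∀ s s′ → letter s ≡ letter s′ → s ≡ s′
  letter-injective blank     blank     refl = refl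
  letter-injective (bit b)   (bit b)   refl = refl
  letter-injective (extra i) (extra i) refl = refl

  isState : Fin states → Maybe (Fin states) → Bool
  isState = has Fin._≟_

  isLetter : Letter → Symbol aux → Bool
  isLetter a s = has (Sum.≡-dec Bool._≟_ Fin._≟_) a (letter s)

  -- The state, or nothing after the machine has halted and accepted, and the scanned symbols.
  Signature : Set
  Signature = Maybe (Fin states) × Vec (Symbol aux) tapes

  Rule : Set
  Rule = Signature × Maybe (Fin states) × Vec (Symbol aux × Move) tapes

  Conf : Set
  Conf = Maybe (Fin states) × Vec (Tape aux) tapes

  -- A track is the bit telling whether the state is q, or whether a cell of tape i holds the letter a.
  Track : Set
  Track = Fin states ⊎ Fin tapes × Letter

  signature : Conf → Signature
  signature (q , ts) = q , Vec.map head ts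

  fire : Rule → Conf → Conf
  fire (_ , q , as) (_ , ts) = q , zipWith writeAndMove as ts

  final : Signature
  final = nothing , Vec.replicate tapes blank

  bitOf : Track → Signature → Bool
  bitOf (inj₁ q)       (q′ , ss) = isState q q′
  bitOf (inj₂ (i , a)) (q′ , ss) = isLetter a (lookup ss i)

  ruleTurn : Track → Rule → Turn
  ruleTurn τ@(inj₁ q)       (σ , q′ , as) = bitOf τ σ , isState q q′ , stay
  ruleTurn τ@(inj₂ (i , a)) (σ , q′ , as) = bitOf τ σ , isLetter a (proj₁ (lookup as i)) , proj₂ (lookup as i)

  view : Track → Conf → Word × Bool × Word
  view (inj₁ q)       (q′ , ts) = [] , isState q q′ , []
  view (inj₂ (i , a)) (q′ , ts) = List.map (isLetter a) (left t) , isLetter a (head t) , List.map (isLetter a) (right t)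
    where t = lookup ts i

  -- Compares `hd r` and `tl r` because an empty `r` and a single 0 stand for the same tape.
  Shows : Track → Conf → Word × Word → Set
  Shows τ c (l , r) = (l , hd r , tl r) ≡ view τ c

  vector-ext : ∀ {A : Set} {n} (v v′ : Vec A n) → (∀ i → lookup v i ≡ lookup v′ i) → v ≡ v′
  vector-ext []      []        h = refl
  vector-ext (a ∷ v) (a′ ∷ v′) h = cong₂ _∷_ (h zero) (vector-ext v v′ (h ∘ suc))

  -- The reason why separate checks of single bits lose nothing: together they determine the state
  -- and every scanned symbol.
  bitOf-injective : ∀ σ σ′ → (∀ τ → bitOf τ σ ≡ bitOf τ σ′) → σ ≡ σ′
  bitOf-injective (q , ss) (q′ , ss′) h = cong₂ _,_ (has-injective Fin._≟_ q q′ (λ a → h (inj₁ a)))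
    (vector-ext ss ss′ (λ i → letter-injective _ _ (has-injective _ _ _ (λ a → h (inj₂ (i , a))))))

  bitOf-final : ∀ τ → bitOf τ final ≡ false
  bitOf-final (inj₁ q)       = refl
  bitOf-final (inj₂ (i , a)) = cong (isLetter a) (lookup-replicate i blank)

  shows-bit : ∀ τ c h → Shows τ c h → hd (proj₂ h) ≡ bitOf τ (signature c)
  shows-bit (inj₁ q)       c         h e = cong (proj₁ ∘ proj₂) e
  shows-bit (inj₂ (i , a)) (q′ , ts) h e = trans (cong (proj₁ ∘ proj₂) e) (cong (isLetter a) (sym (lookup-map i head ts)))

  shows-move : ∀ a s m t {l r} → (l , hd r , tl r) ≡ (List.map (isLetter a) (left t) , isLetter a (head t) , List.map (isLetter a) (right t)) →
    let t′ = writeAndMove (s , m) t ; l′ , r′ = turn (isLetter a s) m (l , r) in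
    (l′ , hd r′ , tl r′) ≡ (List.map (isLetter a) (left t′) , isLetter a (head t′) , List.map (isLetter a) (right t′))
  shows-move a s stay  (tape ls h rs) {l} {r} e =
    cong₂ (λ l r → l , isLetter a s , r) (cong proj₁ e) (cong (proj₂ ∘ proj₂) e)
  shows-move a s moveL (tape [] h rs) {l} {r} e =
    cong₂ (λ l r → tl l , hd l , isLetter a s ∷ r) (cong proj₁ e) (cong (proj₂ ∘ proj₂) e)
  shows-move a s moveL (tape (_ ∷ ls) h rs) {l} {r} e =
    cong₂ (λ l r → tl l , hd l , isLetter a s ∷ r) (cong proj₁ e) (cong (proj₂ ∘ proj₂) e)
  shows-move a s moveR (tape ls h []) {l} {r} e =
    cong₂ (λ l r → isLetter a s ∷ l , hd r , tl r) (cong proj₁ e) (cong (proj₂ ∘ proj₂) e)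
  shows-move a s moveR (tape ls h (_ ∷ rs)) {l} {r} e =
    cong₂ (λ l r → isLetter a s ∷ l , hd r , tl r) (cong proj₁ e) (cong (proj₂ ∘ proj₂) e)

  next : Track → Rule → Word × Word → Word × Word
  next τ ρ h = let _ , b , m = ruleTurn τ ρ in turn b m h

  shows-fire : ∀ τ ρ c h → Shows τ c h → Shows τ (fire ρ c) (next τ ρ h)
  shows-fire (inj₁ q)       (σ , q′ , as) (_ , ts) (l , r) e = cong₂ (λ l r → l , isState q q′ , r) (cong proj₁ e) (cong (proj₂ ∘ proj₂) e)
  shows-fire (inj₂ (i , a)) (σ , q′ , as) (_ , ts) (l , r) e rewrite lookup-zipWith writeAndMove i as ts =
    shows-move a (proj₁ (lookup as i)) (proj₂ (lookup as i)) (lookup ts i) {l} {r} e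

  Valid : List Rule → Conf → Set
  Valid []       c = signature c ≡ final
  Valid (ρ ∷ ρs) c = signature c ≡ proj₁ ρ × Valid ρs (fire ρ c)

  ruleTurn-expects : ∀ τ ρ → proj₁ (ruleTurn τ ρ) ≡ bitOf τ (proj₁ ρ)
  ruleTurn-expects (inj₁ _) ρ = refl
  ruleTurn-expects (inj₂ _) ρ = refl

  -- What a rule writes on a track, and how it moves there, depends on the rule alone, so the tracks
  -- evolve independently. They are brought together only in comparing signatures, by
  -- `bitOf-injective`.
  succeeds⇔valid : ∀ ρs c (h : Track → Word × Word) → (∀ τ → Shows τ c (h τ)) →
    (∀ τ → Succeeds (List.map (ruleTurn τ) ρs) (h τ)) ⇔ Valid ρs c
  succeeds⇔valid [] c h shows = mk⇔
    (λ s → bitOf-injective (signature c) final (λ τ → trans (sym (shows-bit τ c (h τ) (shows τ))) (trans (s τ) (sym (bitOf-final τ)))))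
    (λ e τ → trans (shows-bit τ c (h τ) (shows τ)) (trans (cong (bitOf τ) e) (bitOf-final τ)))
  succeeds⇔valid (ρ ∷ ρs) c h shows = mk⇔
    (λ s → bitOf-injective (signature c) (proj₁ ρ) (λ τ → trans (sym (shows-bit τ c (h τ) (shows τ))) (trans (proj₁ (s τ)) (ruleTurn-expects τ ρ)))
         , Equivalence.to rest (λ τ → proj₂ (s τ)))
    (λ { (e , v) τ → trans (shows-bit τ c (h τ) (shows τ)) (trans (cong (bitOf τ) e) (sym (ruleTurn-expects τ ρ))) , Equivalence.from rest v τ })
    where
    rest : (∀ τ → Succeeds (List.map (ruleTurn τ) ρs) (next τ ρ (h τ))) ⇔ Valid ρs (fire ρ c)
    rest = succeeds⇔valid ρs (fire ρ c) (λ τ → next τ ρ (h τ)) (λ τ → shows-fire τ ρ c (h τ) (shows τ))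

  -- Erases the state and the scanned symbols, which yields `final`. As the rules of the machine all
  -- require a state, it is the only way to get there and ends the computation.
  stop : Fin states × Vec (Symbol aux) tapes → Rule
  stop (q , ss) = (just q , ss) , nothing , Vec.replicate tapes (blank , stay)

  go : Fin states × Vec (Symbol aux) tapes → Action → Rule
  go (q , ss) (q′ , as) = (just q , ss) , just q′ , as

  data Legal : Rule → Set where
    legal-stop : ∀ {q ss} → δ q ss ≡ [] → accept q ≡ true → Legal (stop (q , ss))
    legal-go   : ∀ {q ss a} → a ∈ˡ δ q ss → Legal (go (q , ss) a)

  stops : Fin states × Vec (Symbol aux) tapes → List Action → Bool → List Rule
  stops σ [] true = [ stop σ ]
  stops σ _  _    = []

  rulesAt : Fin states × Vec (Symbol aux) tapes → List Rule
  rulesAt (q , ss) = stops (q , ss) (δ q ss) (accept q) ++ List.map (go (q , ss)) (δ q ss)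

  letters : List Letter
  letters = inj₁ false ∷ inj₁ true ∷ List.map inj₂ (List.allFin aux)

  symbols : List (Symbol aux)
  symbols = blank ∷ bit false ∷ bit true ∷ List.map extra (List.allFin aux)

  rules : List Rule
  rules = List.concatMap rulesAt (List.cartesianProduct (List.allFin states) (vectors symbols tapes))

  tracks : List Track
  tracks = List.map inj₁ (List.allFin states) ++ List.map inj₂ (List.cartesianProduct (List.allFin tapes) letters)

  ∈-letters : ∀ a → a ∈ˡ letters
  ∈-letters (inj₁ false) = here refl
  ∈-letters (inj₁ true)  = there (here refl)
  ∈-letters (inj₂ i)     = there (there (∈-map⁺ inj₂ (∈-allFin i)))

  ∈-symbols : ∀ s → s ∈ˡ symbols
  ∈-symbols blank       = here refl
  ∈-symbols (bit false) = there (here refl)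
  ∈-symbols (bit true)  = there (there (here refl))
  ∈-symbols (extra i)   = there (there (there (∈-map⁺ extra (∈-allFin i))))

  ∈-tracks : ∀ τ → τ ∈ˡ tracks
  ∈-tracks (inj₁ q)       = ∈-++⁺ˡ (∈-map⁺ inj₁ (∈-allFin q))
  ∈-tracks (inj₂ (i , a)) = ∈-++⁺ʳ _ (∈-map⁺ inj₂ (∈-cartesianProduct⁺ (∈-allFin i) (∈-letters a)))

  ∈-rules : ∀ q ss {ρ} → ρ ∈ˡ rulesAt (q , ss) → ρ ∈ˡ rules
  ∈-rules q ss ρ∈ = ∈-concatMap⁺ rulesAt (Any.map (λ { refl → ρ∈ }) (∈-cartesianProduct⁺ (∈-allFin q) (∈-vectors ∈-symbols ss)))

  stop∈rules : ∀ {q ss} → δ q ss ≡ [] → accept q ≡ true → stop (q , ss) ∈ˡ rules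
  stop∈rules {q} {ss} e a = ∈-rules q ss (∈-++⁺ˡ (subst₂ (λ as b → stop (q , ss) ∈ˡ stops (q , ss) as b) (sym e) (sym a) (here refl)))

  go∈rules : ∀ {q ss a} → a ∈ˡ δ q ss → go (q , ss) a ∈ˡ rules
  go∈rules {q} {ss} a∈ = ∈-rules q ss (∈-++⁺ʳ (stops (q , ss) (δ q ss) (accept q)) (∈-map⁺ (go (q , ss)) a∈))

  rules-legal : All Legal rules
  rules-legal = All.concat⁺ (All.map⁺ (All.universal legalAt (List.cartesianProduct (List.allFin states) (vectors symbols tapes))))
    where
    stops-legal : ∀ σ {as b} → δ (proj₁ σ) (proj₂ σ) ≡ as → accept (proj₁ σ) ≡ b → All Legal (stops σ as b)
    stops-legal σ {[]}     {true}  e a = legal-stop e a ∷ []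
    stops-legal σ {[]}     {false} e a = []
    stops-legal σ {_ ∷ _}          e a = []
    legalAt : ∀ σ → All Legal (rulesAt σ)
    legalAt (q , ss) = All.++⁺ (stops-legal (q , ss) refl refl) (All.map⁺ (All.tabulate legal-go))

  valid⇒good : ∀ ρs q ts → All Legal ρs → Valid ρs (just q , ts) → Good N (config q ts)
  valid⇒good (_ ∷ ρs) q ts (legal-stop e a ∷ ls) (refl , v) = 0 , _ , done , e , a
  valid⇒good (_ ∷ ρs) q ts (legal-go {a = q′ , as} a∈ ∷ ls) (refl , v) with valid⇒good ρs q′ _ ls v
  ... | t , d , r , h , acc = suc t , d , step (q′ , as) a∈ r , h , acc

  good⇒valid : ∀ {t q ts d} → Runs N t (config q ts) d → Halted N d → accept (Config.state d) ≡ true →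
    ∃[ ρs ] All (_∈ˡ rules) ρs × length ρs ≡ suc t × Valid ρs (just q , ts)
  good⇒valid {ts = ts} done h acc = _ , stop∈rules h acc ∷ [] , refl , refl , cong (nothing ,_) (stopped ts)
    where
    stopped : ∀ {n} (ts : Vec (Tape aux) n) → Vec.map head (zipWith writeAndMove (Vec.replicate n (blank , stay)) ts) ≡ Vec.replicate n blank
    stopped []       = refl
    stopped (t ∷ ts) = cong (blank ∷_) (stopped ts)
  good⇒valid (step a a∈ r) h acc with good⇒valid r h acc
  ... | ρs , ρs∈ , l , v = _ , go∈rules a∈ ∷ ρs∈ , cong suc l , refl , v

  loads : Word → Track → Word
  loads x (inj₁ q)           = [ isState q (just start) ]
  loads x (inj₂ (zero , a))  = List.map (isLetter a ∘ bit) (reverse x)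
  loads x (inj₂ (suc i , a)) = []

  loaded : Word → Track → Word × Word
  loaded x τ = [] , loads x τ ʳ++ []

  loaded-shows : ∀ x τ → Shows τ (just start , Config.contents (initial N x)) (loaded x τ)
  loaded-shows x (inj₁ q)           = refl
  loaded-shows x (inj₂ (zero , a))  = subst (λ r → ([] , hd r , tl r) ≡ view (inj₂ (zero , a)) (just start , Config.contents (initial N x)))
      (sym eq) (shown x)
    where
    f : Bool → Bool
    f = isLetter a ∘ bit
    eq : List.map f (reverse x) ʳ++ [] ≡ List.map f x
    eq = trans (ʳ++-defn (List.map f (reverse x))) (trans (++-identityʳ _) (trans (cong reverse (reverse-map f x)) (reverse-involutive _)))
    shown : ∀ x → ([] , hd (List.map f x) , tl (List.map f x)) ≡ view (inj₂ (zero , a)) (just start , Config.contents (initial N x))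
    shown []      = refl
    shown (b ∷ x) = cong (λ r → [] , f b , r) (map-∘ x)
  loaded-shows x (inj₂ (suc i , a)) rewrite lookup-replicate i (emptyTape N) = refl

  section : ℕ → Word → Track → Section
  section T x τ = loads x τ , List.map (ruleTurn τ) (copies T rules)

  code : ℕ → Word → Word
  code T x = List.concatMap sectionCode (List.map (section T x) tracks)

  accepts⇔universal : ∀ T x → (∀ {t c} → Runs N t (initial N x) c → t < T) →
    Accepts N x ⇔ padded (reverse (code T x)) ∈ Universal
  accepts⇔universal T x bound = mk⇔ to from
    where
    y : Word
    y = padded (reverse (code T x))
    c₀ : Conf
    c₀ = just start , Config.contents (initial N x)
    sections : List Section
    sections = List.map (section T x) tracks
    to : Accepts N x → y ∈ Universal
    to (t , d , r , h , acc) with good⇒valid r h acc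
    ... | ρs , ρs∈ , l , v with select-copies rules T ρs ρs∈ (≤-trans (≤-reflexive l) (bound r))
    ...   | w₀ , l₀ , eq = w , length-w , Equivalence.from (sections-universal sections w)
              (All.map⁺ (All.universal (λ τ → subst (λ ts → Succeeds ts (loaded x τ))
                (trans (cong (List.map (ruleTurn τ)) (sym selected)) (sym (select-map (ruleTurn τ) w (copies T rules))))
                (Equivalence.from (succeeds⇔valid ρs c₀ (loaded x) (loaded-shows x)) v τ)) tracks))
      where
      -- A certificate must be exactly as long as the instance; the zeros appended select nothing.
      w : Word
      w = w₀ ++ zeros (length y ∸ length w₀)
      selected : select w (copies T rules) ≡ ρs
      selected = trans (select-++-zeros w₀ _ (copies T rules)) eq
      short : length w₀ ≤ length y
      short = begin
        length w₀                         ≡⟨ l₀ ⟩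
        -- All tracks list equally many turns; the start state provides one track to count them on.
        length (copies T rules)           ≡⟨ sym (length-map (ruleTurn (inj₁ start)) (copies T rules)) ⟩
        length (proj₂ (section T x (inj₁ start))) ≤⟨ sectionCode-length (∈-map⁺ (section T x) (∈-tracks (inj₁ start))) ⟩
        length (code T x)                 ≡⟨ sym (length-reverse (code T x)) ⟩
        length (reverse (code T x))       ≤⟨ n≤1+n _ ⟩
        suc (length (reverse (code T x))) ≤⟨ m≤n+m _ _ ⟩
        paddedLength (length (reverse (code T x))) ≡⟨ sym (length-padded (reverse (code T x))) ⟩
        length y                          ∎
        where open ≤-Reasoning hiding (start)
      length-w : length w ≡ length y
      length-w = trans (length-++ w₀) (trans (cong (length w₀ +_) (length-replicate _)) (m+[n∸m]≡n short))
    from : y ∈ Universal → Accepts N x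
    from (w , _ , a) = valid⇒good (select w (copies T rules)) start _ (All-select w (All-copies T rules-legal))
      (Equivalence.to (succeeds⇔valid (select w (copies T rules)) c₀ (loaded x) (loaded-shows x)) λ τ →
        subst (λ ts → Succeeds ts (loaded x τ)) (select-map (ruleTurn τ) w (copies T rules))
          (All.lookup (All.map⁻ (Equivalence.to (sections-universal sections w) a)) (∈-tracks τ)))

-- Universal is NP-hard

work : Word → Word → Word → ℕ → ℕ → ℕ → ℕ → ℕ → Stacks 11
work o x y t u n a b = o ∷ x ∷ y ∷ zeros t ∷ zeros u ∷ zeros n ∷ zeros a ∷ zeros b ∷ [] ∷ [] ∷ [] ∷ [] ∷ []

setup : Prog 11
setup = for (# 0) (λ b → push (# 1) [ b ] ⨾ push (# 5) [ false ])

setup-efficient : Efficient setup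
setup-efficient = tame-efficient (λ i → i == # 1) setup tt

eval-setup : ∀ x → eval setup (x ∷ Vec.replicate 11 []) ≡ work [] (reverse x) [] 0 0 (length x) 0 0
eval-setup x = trans (go x [] 0) (cong (λ n → work [] (reverse x) [] 0 0 n 0 0) (+-identityʳ _))
  where
  go : ∀ x y n → eval setup (work x y [] 0 0 n 0 0) ≡ work [] (x ʳ++ y) [] 0 0 (length x + n) 0 0
  go []      y n = refl
  go (b ∷ x) y n = trans (go x (b ∷ y) (suc n)) (cong (λ m → work [] (x ʳ++ (b ∷ y)) [] 0 0 m 0 0) (+-suc (length x) n))

-- With n on stack 5 and r on stack 3, both in unary, Horner's step replaces r by a + n r.
addOnce : Prog 11
addOnce = for (# 3) (λ _ → push (# 4) [ false ] ⨾ push (# 6) [ false ]) ⨾ for (# 6) (λ _ → push (# 3) [ false ]) ⨾ push (# 7) [ false ]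

multiply : Prog 11
multiply = for (# 5) (λ _ → addOnce)

addConstant : ℕ → Prog 11
addConstant a = for (# 7) (λ _ → push (# 5) [ false ]) ⨾ for (# 3) (λ _ → skip) ⨾ push (# 4) (zeros a) ⨾ for (# 4) (λ _ → push (# 3) [ false ])

horner : Polynomial → Prog 11
horner []      = skip
horner (a ∷ p) = horner p ⨾ multiply ⨾ addConstant a

-- In `multiply` the product accumulates on stack 4, which must be free there, whereas `addConstant`
-- loops over that stack.
horner-efficient : ∀ p → Efficient (horner p)
horner-efficient []      = tame-efficient (λ _ → false) skip tt
horner-efficient (a ∷ p) = ⨾-efficient {p = horner p} {multiply ⨾ addConstant a} (horner-efficient p)
  (⨾-efficient {p = multiply} {addConstant a} (tame-efficient (λ i → i == # 4) multiply tt) (tame-efficient (λ _ → false) (addConstant a) tt))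

module _ (x : Word) where

  eval-add : ∀ r u n k b → eval (for (# 3) (λ _ → push (# 4) [ false ] ⨾ push (# 6) [ false ])) (work [] x [] r u n k b)
                         ≡ work [] x [] 0 (r + u) n (r + k) b
  eval-add zero    u n k b = refl
  eval-add (suc r) u n k b = trans (eval-add r (suc u) n (suc k) b) (cong₂ (λ u k → work [] x [] 0 u n k b) (+-suc r u) (+-suc r k))

  eval-back : ∀ k r u n b → eval (for (# 6) (λ _ → push (# 3) [ false ])) (work [] x [] r u n k b) ≡ work [] x [] (k + r) u n 0 b
  eval-back zero    r u n b = refl
  eval-back (suc k) r u n b = trans (eval-back k (suc r) u n b) (cong (λ r → work [] x [] r u n 0 b) (+-suc k r))

  eval-addOnce : ∀ r u n b → eval addOnce (work [] x [] r u n 0 b) ≡ work [] x [] r (r + u) n 0 (suc b)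
  eval-addOnce r u n b = cong (eval (push (# 7) [ false ])) (trans (cong (eval (for (# 6) (λ _ → push (# 3) [ false ]))) (eval-add r u n 0 b))
    (trans (eval-back (r + 0) 0 (r + u) n b) (cong (λ t → work [] x [] t (r + u) n 0 b) (trans (+-identityʳ _) (+-identityʳ r)))))

  eval-multiply : ∀ n r u b → eval multiply (work [] x [] r u n 0 b) ≡ work [] x [] r (n * r + u) 0 0 (n + b)
  eval-multiply zero    r u b = refl
  eval-multiply (suc n) r u b = trans (cong (loop (length (zeros n)) (# 5) (λ _ → eval addOnce)) (eval-addOnce r u n b))
    (trans (eval-multiply n r (r + u) (suc b)) (cong₂ (λ u b → work [] x [] r u 0 0 b)
      (trans (sym (+-assoc (n * r) r u)) (cong (_+ u) (+-comm (n * r) r))) (+-suc n b)))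

  eval-count : ∀ b n r u → eval (for (# 7) (λ _ → push (# 5) [ false ])) (work [] x [] r u n 0 b) ≡ work [] x [] r u (b + n) 0 0
  eval-count zero    n r u = refl
  eval-count (suc b) n r u = trans (eval-count b (suc n) r u) (cong (λ n → work [] x [] r u n 0 0) (+-suc b n))

  eval-drop : ∀ r u n → eval (for (# 3) (λ _ → skip)) (work [] x [] r u n 0 0) ≡ work [] x [] 0 u n 0 0
  eval-drop zero    u n = refl
  eval-drop (suc r) u n = eval-drop r u n

  eval-result : ∀ u r n → eval (for (# 4) (λ _ → push (# 3) [ false ])) (work [] x [] r u n 0 0) ≡ work [] x [] (u + r) 0 n 0 0
  eval-result zero    r n = refl
  eval-result (suc u) r n = trans (eval-result u (suc r) n) (cong (λ r → work [] x [] r 0 n 0 0) (+-suc u r))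

  eval-horner : ∀ p n → eval (horner p) (work [] x [] 0 0 n 0 0) ≡ work [] x [] (⟦ p ⟧ n) 0 n 0 0
  eval-horner []      n = refl
  eval-horner (a ∷ p) n = begin
    eval (addConstant a) (eval multiply (eval (horner p) (work [] x [] 0 0 n 0 0)))
      ≡⟨ cong (eval (addConstant a) ∘ eval multiply) (eval-horner p n) ⟩
    eval (addConstant a) (eval multiply (work [] x [] r 0 n 0 0))
      ≡⟨ cong (eval (addConstant a)) (trans (eval-multiply n r 0 0) (cong₂ (λ u b → work [] x [] r u 0 0 b) (+-identityʳ _) (+-identityʳ n))) ⟩
    eval (addConstant a) (work [] x [] r (n * r) 0 0 n)
      ≡⟨ cong (eval finish ∘ eval (push (# 4) (zeros a)) ∘ eval (for (# 3) (λ _ → skip)))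
              (trans (eval-count n 0 r (n * r)) (cong (λ n′ → work [] x [] r (n * r) n′ 0 0) (+-identityʳ n))) ⟩
    eval finish (eval (push (# 4) (zeros a)) (eval (for (# 3) (λ _ → skip)) (work [] x [] r (n * r) n 0 0)))
      ≡⟨ cong (eval finish ∘ eval (push (# 4) (zeros a))) (eval-drop r (n * r) n) ⟩
    eval finish (eval (push (# 4) (zeros a)) (work [] x [] 0 (n * r) n 0 0))
      ≡⟨ cong (λ u → eval finish ([] ∷ x ∷ [] ∷ [] ∷ u ∷ zeros n ∷ [] ∷ [] ∷ [] ∷ [] ∷ [] ∷ [] ∷ [])) (zeros-ʳ++ a (n * r)) ⟩
    eval finish (work [] x [] 0 (a + n * r) n 0 0)
      ≡⟨ trans (eval-result (a + n * r) 0 n) (cong (λ r → work [] x [] r 0 n 0 0) (+-identityʳ _)) ⟩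
    work [] x [] (a + n * r) 0 n 0 0 ∎
    where
    open ≡-Reasoning
    r : ℕ
    r = ⟦ p ⟧ n
    finish : Prog 11
    finish = for (# 4) (λ _ → push (# 3) [ false ])

-- The output is assembled on stack 0, where it ends up reversed; the reversed input is on stack 1.
emitLetters : (Bool → Bool) → Prog 11
emitLetters f = for (# 1) (λ b → push (# 0) (loadCode (f b)) ⨾ push (# 2) [ b ]) ⨾ for (# 2) (λ b → push (# 1) [ b ])

emitCopies : Word → Prog 11
emitCopies r = for (# 3) (λ _ → push (# 0) r ⨾ push (# 4) [ false ]) ⨾ for (# 4) (λ _ → push (# 3) [ false ])

module _ (n : ℕ) where

  eval-emitLetters : ∀ f x o t → eval (emitLetters f) (work o x [] t 0 n 0 0) ≡ work (List.concatMap loadCode (List.map f x) ʳ++ o) x [] t 0 n 0 0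
  eval-emitLetters f x o t = trans (cong (eval (for (# 2) (λ b → push (# 1) [ b ]))) (forth x [] o))
    (trans (back (x ʳ++ []) [] (List.concatMap loadCode (List.map f x) ʳ++ o))
      (cong (λ x′ → work (List.concatMap loadCode (List.map f x) ʳ++ o) x′ [] t 0 n 0 0) (trans (ʳ++-ʳ++ x) (++-identityʳ x))))
    where
    forth : ∀ x y o → eval (for (# 1) (λ b → push (# 0) (loadCode (f b)) ⨾ push (# 2) [ b ])) (work o x y t 0 n 0 0)
                    ≡ work (List.concatMap loadCode (List.map f x) ʳ++ o) [] (x ʳ++ y) t 0 n 0 0
    forth []      y o = refl
    forth (b ∷ x) y o = forth x (b ∷ y) (loadCode (f b) ʳ++ o)
    back : ∀ y x o → eval (for (# 2) (λ b → push (# 1) [ b ])) (work o x y t 0 n 0 0) ≡ work o (y ʳ++ x) [] t 0 n 0 0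
    back []      x o = refl
    back (b ∷ y) x o = back y (b ∷ x) o

  eval-emitCopies : ∀ r x o t → eval (emitCopies r) (work o x [] t 0 n 0 0) ≡ work (List.concat (replicate t r) ʳ++ o) x [] t 0 n 0 0
  eval-emitCopies r x o t = trans (cong (eval (for (# 4) (λ _ → push (# 3) [ false ]))) (forth t 0 o))
    (trans (back (t + 0) 0 (List.concat (replicate t r) ʳ++ o))
      (cong (λ t′ → work (List.concat (replicate t r) ʳ++ o) x [] t′ 0 n 0 0) (trans (+-identityʳ _) (+-identityʳ t))))
    where
    forth : ∀ t u o → eval (for (# 3) (λ _ → push (# 0) r ⨾ push (# 4) [ false ])) (work o x [] t u n 0 0)
                    ≡ work (List.concat (replicate t r) ʳ++ o) x [] 0 (t + u) n 0 0
    forth zero    u o = refl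
    forth (suc t) u o = trans (forth t (suc u) (r ʳ++ o))
      (cong₂ (λ o u → work o x [] 0 u n 0 0) (sym (++-ʳ++ r)) (+-suc t u))
    back : ∀ u t o → eval (for (# 4) (λ _ → push (# 3) [ false ])) (work o x [] t u n 0 0) ≡ work o x [] (u + t) 0 n 0 0
    back zero    t o = refl
    back (suc u) t o = trans (back u (suc t) o) (cong (λ t → work o x [] t 0 n 0 0) (+-suc u t))

clearInput : Prog 11
clearInput = for (# 1) (λ _ → skip) ⨾ for (# 3) (λ _ → skip)

eval-clearInput : ∀ o x t n → eval clearInput (work o x [] t 0 n 0 0) ≡ work o [] [] 0 0 n 0 0
eval-clearInput o (b ∷ x) t       n = eval-clearInput o x t n
eval-clearInput o []      (suc t) n = eval-clearInput o [] t n
eval-clearInput o []      zero    n = refl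

-- The reduction of a nondeterministic machine to the universal set

module Reduction (N : Machine) (p : Polynomial) where
  open Machine N
  open Encoding N

  emitLoads : Track → Prog 11
  emitLoads (inj₁ q)           = push (# 0) (loadCode (isState q (just start)))
  emitLoads (inj₂ (zero , a))  = emitLetters (isLetter a ∘ bit)
  emitLoads (inj₂ (suc i , a)) = skip

  rulesCode : Track → Word
  rulesCode τ = List.concatMap turnCode (List.map (ruleTurn τ) rules)

  emit : Track → Prog 11
  emit τ = emitLoads τ ⨾ emitCopies (rulesCode τ) ⨾ push (# 0) endCode

  -- The tracks and the code of the rules depend on the machine and not on its input, so they are
  -- built into the program. Only the input letters and the number of copies vary.
  emits : List Track → Prog 11
  emits []       = skip
  emits (τ ∷ τs) = emit τ ⨾ emits τs

  emitLoads-efficient : ∀ τ → Efficient (emitLoads τ)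
  emitLoads-efficient τ@(inj₁ q)           = tame-efficient (λ i → i == # 0) (emitLoads τ) tt
  emitLoads-efficient τ@(inj₂ (zero , a))  = tame-efficient (λ i → i == # 0) (emitLoads τ) tt
  emitLoads-efficient τ@(inj₂ (suc i , a)) = tame-efficient (λ i → i == # 0) (emitLoads τ) tt

  copies-efficient : ∀ r → Efficient (emitCopies r ⨾ push (# 0) endCode)
  copies-efficient r = tame-efficient (λ i → i == # 0) (emitCopies r ⨾ push (# 0) endCode) tt

  emits-efficient : ∀ τs → Efficient (emits τs)
  emits-efficient []       = tame-efficient (λ _ → false) skip tt
  emits-efficient (τ ∷ τs) = ⨾-efficient {p = emit τ} {emits τs}
    (⨾-efficient {p = emitLoads τ} {emitCopies (rulesCode τ) ⨾ push (# 0) endCode} (emitLoads-efficient τ) (copies-efficient (rulesCode τ)))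
    (emits-efficient τs)

  -- One more than the bound on the running time, to make room for the rule `stop`.
  time : Word → ℕ
  time x = suc (⟦ p ⟧ (length x))

  -- The push on stack 3 adds the copy reserved for `stop`. The input and the counter are cleared
  -- because `pad` expects stacks 1 to 4 to be empty.
  reduce : Prog 11
  reduce = setup ⨾ horner p ⨾ push (# 3) [ false ] ⨾ emits tracks ⨾ clearInput ⨾ pad

  reduce-efficient : Efficient reduce
  reduce-efficient =
    ⨾-efficient {p = setup} {horner p ⨾ push (# 3) [ false ] ⨾ emits tracks ⨾ clearInput ⨾ pad} setup-efficient
    (⨾-efficient {p = horner p} {push (# 3) [ false ] ⨾ emits tracks ⨾ clearInput ⨾ pad} (horner-efficient p)
    (⨾-efficient {p = push (# 3) [ false ]} {emits tracks ⨾ clearInput ⨾ pad} (tame-efficient (λ _ → false) (push (# 3) [ false ]) tt)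
    (⨾-efficient {p = emits tracks} {clearInput ⨾ pad} (emits-efficient tracks)
    (⨾-efficient {p = clearInput} {pad} (tame-efficient (λ _ → false) clearInput tt) pad-efficient))))

  concat-copies : ∀ τ t → List.concat (replicate t (rulesCode τ)) ≡ List.concatMap turnCode (List.map (ruleTurn τ) (copies t rules))
  concat-copies τ zero    = refl
  concat-copies τ (suc t) = begin
    rulesCode τ ++ List.concat (replicate t (rulesCode τ))
      ≡⟨ cong (rulesCode τ ++_) (concat-copies τ t) ⟩
    rulesCode τ ++ List.concatMap turnCode (List.map (ruleTurn τ) (copies t rules))
      ≡⟨ sym (concatMap-++ turnCode (List.map (ruleTurn τ) rules) (List.map (ruleTurn τ) (copies t rules))) ⟩
    List.concatMap turnCode (List.map (ruleTurn τ) rules ++ List.map (ruleTurn τ) (copies t rules))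
      ≡⟨ cong (List.concatMap turnCode) (sym (map-++ (ruleTurn τ) rules (copies t rules))) ⟩
    List.concatMap turnCode (List.map (ruleTurn τ) (copies (suc t) rules)) ∎
    where open ≡-Reasoning

  module _ (x : Word) (n : ℕ) where

    eval-emitLoads : ∀ τ o t → eval (emitLoads τ) (work o (reverse x) [] t 0 n 0 0)
      ≡ work (List.concatMap loadCode (loads x τ) ʳ++ o) (reverse x) [] t 0 n 0 0
    eval-emitLoads (inj₁ q)           o t = refl
    eval-emitLoads (inj₂ (zero , a))  o t = eval-emitLetters n (isLetter a ∘ bit) (reverse x) o t
    eval-emitLoads (inj₂ (suc i , a)) o t = refl

    eval-emit : ∀ τ o t → eval (emit τ) (work o (reverse x) [] t 0 n 0 0) ≡ work (sectionCode (section t x τ) ʳ++ o) (reverse x) [] t 0 n 0 0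
    eval-emit τ o t = begin
      eval end (eval (emitCopies (rulesCode τ)) (eval (emitLoads τ) (W o)))
        ≡⟨ cong (eval end ∘ eval (emitCopies (rulesCode τ))) (eval-emitLoads τ o t) ⟩
      eval end (eval (emitCopies (rulesCode τ)) (W (ls ʳ++ o)))
        ≡⟨ cong (eval end) (eval-emitCopies n (rulesCode τ) (reverse x) (ls ʳ++ o) t) ⟩
      W (endCode ʳ++ (List.concat (replicate t (rulesCode τ)) ʳ++ (ls ʳ++ o)))
        ≡⟨ cong (λ c → W (endCode ʳ++ (c ʳ++ (ls ʳ++ o)))) (concat-copies τ t) ⟩
      W (endCode ʳ++ (ts ʳ++ (ls ʳ++ o)))
        ≡⟨ cong W (sym (++-ʳ++ ts)) ⟩
      W ((ts ++ endCode) ʳ++ (ls ʳ++ o))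
        ≡⟨ cong W (sym (++-ʳ++ ls)) ⟩
      W (sectionCode (section t x τ) ʳ++ o) ∎
      where
      open ≡-Reasoning
      end : Prog 11
      end = push (# 0) endCode
      W : Word → Stacks 11
      W o = work o (reverse x) [] t 0 n 0 0
      ls ts : Word
      ls = List.concatMap loadCode (loads x τ)
      ts = List.concatMap turnCode (List.map (ruleTurn τ) (copies t rules))

    eval-emits : ∀ τs o t → eval (emits τs) (work o (reverse x) [] t 0 n 0 0)
      ≡ work (List.concatMap sectionCode (List.map (section t x) τs) ʳ++ o) (reverse x) [] t 0 n 0 0
    eval-emits []       o t = refl
    eval-emits (τ ∷ τs) o t = trans (cong (eval (emits τs)) (eval-emit τ o t))
      (trans (eval-emits τs _ t) (cong (λ o → work o (reverse x) [] t 0 n 0 0) (sym (++-ʳ++ (sectionCode (section t x τ))))))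

  eval-reduce : ∀ x → Vec.head (eval reduce (x ∷ Vec.replicate 11 [])) ≡ padded (reverse (code (time x) x))
  eval-reduce x = cong Vec.head (begin
    eval pad (eval clearInput (eval (emits tracks) (eval more (eval (horner p) (eval setup (x ∷ Vec.replicate 11 []))))))
      ≡⟨ cong (eval pad ∘ eval clearInput ∘ eval (emits tracks) ∘ eval more) (trans (cong (eval (horner p)) (eval-setup x)) (eval-horner (reverse x) p (length x))) ⟩
    eval pad (eval clearInput (eval (emits tracks) (work [] (reverse x) [] (time x) 0 (length x) 0 0)))
      ≡⟨ cong (eval pad ∘ eval clearInput) (eval-emits x (length x) tracks [] (time x)) ⟩
    eval pad (eval clearInput (work (reverse (code (time x) x)) (reverse x) [] (time x) 0 (length x) 0 0))
      ≡⟨ cong (eval pad) (eval-clearInput (reverse (code (time x) x)) (reverse x) (time x) (length x)) ⟩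
    eval pad (work (reverse (code (time x) x)) [] [] 0 0 (length x) 0 0)
      ≡⟨ eval-pad (reverse (code (time x) x)) _ ⟩
    _ ∎)
    where
    open ≡-Reasoning
    more : Prog 11
    more = push (# 3) [ false ]

  reduction-computable : PolyTimeComputable (λ x → padded (reverse (code (time x) x)))
  reduction-computable = computable-≗ (efficient⇒computable reduce reduce-efficient) eval-reduce

Universal-hard : ∀ A → InNP A → A ≤ᵖₘ Universal
Universal-hard A (N , (p , terminates) , iff) = (λ x → padded (reverse (code (time x) x))) , reduction-computable , λ x → mk⇔
  (λ x∈ → Equivalence.to (accepts⇔universal (time x) x (λ r → s≤s (terminates x r))) (Equivalence.to (iff x) x∈))
  (λ u → Equivalence.from (iff x) (Equivalence.from (accepts⇔universal (time x) x (λ r → s≤s (terminates x r))) u))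
  where
  open Encoding N
  open Reduction N p

corollary6p6 : (∀ (A : Language) → InNP A → (∃[ x ] x ∈ A) → (∃[ x ] x ∉ A) →
    ∃[ B ] A ≡ᵖₘ B × ¬ TightPaddable B × ¬ TightZPaddable B)
    × (∃[ B ] NPComplete B × ¬ TightPaddable B × ¬ TightZPaddable B)
    × (∃[ B ] InP B × ¬ TightPaddable B × ¬ TightZPaddable B)
corollary6p6 =
    (λ A A∈NP x∈A x∉A → _ , padding A x∉A , padded-¬paddable x∈A , padded-¬paddable x∈A ∘ tightZ⇒tight)
  , (Universal , (Universal-inNP , Universal-hard) , Universal-¬paddable , Universal-¬paddable ∘ tightZ⇒tight)
  , (_≡ []) , emptyOnly-inP , emptyOnly-¬paddable , emptyOnly-¬paddable ∘ tightZ⇒tight
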